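{- For all integers $\omega,\epsilon,p_1,p_2,n\ge0$ there is a bijection $$\psi:\mathcal{D}^*(\omega,\epsilon,p_1,p_2,n)\to\mathcal{D}(\omega,\epsilon,p_1,p_2,n-2(\omega+2\epsilon)),$$ and consequently, for all $m,n\ge 0$, a bijection $\psi:\mathcal{D}^*(m,n)\to\mathcal{D}(m,n-2m)$.
   Context: A Schur partition is a partition of an integer into positive parts such that consecutive parts differ by at least $3$, and no two consecutive parts differing by exactly $3$ are both multiples of $3$. For a partition $\pi$, $m(\pi)$ is the number of parts plus the number of even parts. Upper pairs: in a Schur partition $\pi$, a part $x$ is in an upper pair if $x+3$ or $x-3$ is also a part, except when (i) $x$ is odd and is the largest element of an odd-length maximal arithmetic progression of parts of $\pi$ with common difference $3$, or (ii) $x$ is even and is the smallest element of such an odd-length maximal progression. Lower pairs: a part $x>1$ is in a lower pair if $x+3$ or $x-3$ is also a part, except when (i) $x$ is even and is the largest element of an odd-length maximal arithmetic progression with common difference $3$ of parts greater than $1$, or (ii) $x$ is odd and is the smallest element of such a progression. $\mathcal{D}^*(\omega,\epsilon,p_1,p_2,n)$ is the set of Schur partitions of $n$ in which every odd part is $\ge3$ and every even part is $\ge6$, having $\omega$ odd parts, $\epsilon$ even parts, $p_1$ parts that lie in upper pairs and are $\equiv1\pmod3$, and $p_2$ parts that lie in upper pairs and are $\equiv 2\pmod 3$. $\mathcal{D}(\omega,\epsilon,p_1,p_2,n)$ is the set of Schur partitions of $n$ with $\omega$ odd parts, $\epsilon$ even parts, $p_1$ parts that lie in lower pairs and are $\equiv1\pmod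 3$, and $p_2$ parts that lie in lower pairs and are $\equiv2\pmod3$. $\mathcal{D}(m,n)$ is the set of Schur partitions $\pi$ of $n$ with $m(\pi)=m$, and $\mathcal{D}^*(m,n)$ its subset in which every odd part is $\ge 3$ and every even part is $\ge 6$. Sets with negative $n$ are empty. -}

module Defs where

open import Level using (0ℓ)
open import Data.Nat using (ℕ; suc; _+_; _*_; _∸_; _≤_; _<_; _%_)
open import Data.Nat.Divisibility using (_∣_)
open import Data.Integer as ℤ using (ℤ; +_)
open import Data.List using (List; length)
open import Data.Nat.ListAction using (sum)
open import Data.List.Membership.Propositional using (_∈_)
open import Data.List.Relation.Unary.All using (All)
open import Data.List.Relation.Unary.Linked using (Linked)
open import Data.List.Relation.Binary.Sublist.Propositional using (_⊆_)
open import Data.Product using (Σ; ∃; _×_; _,_; proj₁)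
open import Data.Sum using (_⊎_)
open import Function.Bundles using (_⇔_)
open import Relation.Nullary using (¬_)
open import Relation.Binary.PropositionalEquality as P using (_≡_)
open import Relation.Binary.Bundles using (Setoid)

-- Partitions are lists of parts written in (strictly) decreasing order.

IsOdd IsEven : ℕ → Set
IsOdd x = x % 2 ≡ 1
IsEven x = x % 2 ≡ 0

SchurGap : ℕ → ℕ → Set
SchurGap x y = (y + 3 ≤ x) × ¬ (x ≡ y + 3 × 3 ∣ x × 3 ∣ y)

IsSchur : List ℕ → Set
IsSchur π = All (0 <_) π × Linked SchurGap π

-- "exactly k parts of π satisfy Q"  (parts of a Schur partition are distinct)
CountIs : (ℕ → Set) → List ℕ → ℕ → Set
CountIs Q π k =
  Σ (List ℕ) λ S → (S ⊆ π) × (∀ x → x ∈ π → (x ∈ S ⇔ Q x)) × (length S ≡ k)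

MaxAP : (ℕ → Set) → ℕ → ℕ → Set
MaxAP Q a L =
  (∀ i → i < L → Q (a + 3 * i)) × (∀ b → b + 3 ≡ a → ¬ Q b) × ¬ Q (a + 3 * L)

LargestOfOddAP : (ℕ → Set) → ℕ → Set
LargestOfOddAP Q x = ∃ λ a → ∃ λ L → MaxAP Q a L × IsOdd L × (x ≡ a + 3 * (L ∸ 1))

SmallestOfOddAP : (ℕ → Set) → ℕ → Set
SmallestOfOddAP Q x = ∃ λ a → ∃ λ L → MaxAP Q a L × IsOdd L × (x ≡ a)

HasNeighbour : List ℕ → ℕ → Set
HasNeighbour π x = (x + 3 ∈ π) ⊎ (∃ λ y → y ∈ π × y + 3 ≡ x)

UpperPair : List ℕ → ℕ → Set
UpperPair π x =
  x ∈ π × HasNeighbour π x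
  × ¬ (IsOdd x × LargestOfOddAP (_∈ π) x)
  × ¬ (IsEven x × SmallestOfOddAP (_∈ π) x)

PartGt1 : List ℕ → ℕ → Set
PartGt1 π y = y ∈ π × 1 < y

LowerPair : List ℕ → ℕ → Set
LowerPair π x =
  x ∈ π × 1 < x × HasNeighbour π x
  × ¬ (IsEven x × LargestOfOddAP (PartGt1 π) x)
  × ¬ (IsOdd x × SmallestOfOddAP (PartGt1 π) x)

-- 𝒟(ω,ε,p₁,p₂,N); target size N is an integer, negative N gives the empty set
𝒟-pred : ℕ → ℕ → ℕ → ℕ → ℤ → List ℕ → Set
𝒟-pred ω ε p₁ p₂ N π =
  IsSchur π × (+ sum π ≡ N)
  × CountIs IsOdd π ω × CountIs IsEven π ε
  × CountIs (λ x → LowerPair π x × x % 3 ≡ 1) π p₁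
  × CountIs (λ x → LowerPair π x × x % 3 ≡ 2) π p₂

Restricted : List ℕ → Set
Restricted π = All (λ x → (IsOdd x → 3 ≤ x) × (IsEven x → 6 ≤ x)) π

𝒟*-pred : ℕ → ℕ → ℕ → ℕ → ℕ → List ℕ → Set
𝒟*-pred ω ε p₁ p₂ n π =
  IsSchur π × Restricted π × (sum π ≡ n)
  × CountIs IsOdd π ω × CountIs IsEven π ε
  × CountIs (λ x → UpperPair π x × x % 3 ≡ 1) π p₁
  × CountIs (λ x → UpperPair π x × x % 3 ≡ 2) π p₂

MIs : List ℕ → ℕ → Set
MIs π m = ∃ λ e → CountIs IsEven π e × (length π + e ≡ m)

𝒟m-pred : ℕ → ℤ → List ℕ → Set
𝒟m-pred m N π = IsSchur π × (+ sum π ≡ N) × MIs π m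

𝒟m*-pred : ℕ → ℕ → List ℕ → Set
𝒟m*-pred m n π = IsSchur π × Restricted π × (sum π ≡ n) × MIs π m

PartSetoid : (List ℕ → Set) → Setoid 0ℓ 0ℓ
PartSetoid Q = record
  { Carrier = Σ (List ℕ) Q
  ; _≈_ = λ x y → proj₁ x ≡ proj₁ y
  ; isEquivalence = record { refl = P.refl ; sym = P.sym ; trans = P.trans }
  }

𝒟 : ℕ → ℕ → ℕ → ℕ → ℤ → Setoid 0ℓ 0ℓ
𝒟 ω ε p₁ p₂ N = PartSetoid (𝒟-pred ω ε p₁ p₂ N)

𝒟* : ℕ → ℕ → ℕ → ℕ → ℕ → Setoid 0ℓ 0ℓ
𝒟* ω ε p₁ p₂ n = PartSetoid (𝒟*-pred ω ε p₁ p₂ n)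

𝒟m : ℕ → ℤ → Setoid 0ℓ 0ℓ
𝒟m m N = PartSetoid (𝒟m-pred m N)

𝒟m* : ℕ → ℕ → Setoid 0ℓ 0ℓ
𝒟m* m n = PartSetoid (𝒟m*-pred m n)

{-# OPTIONS --safe #-}

-- Both kinds of pairs decompose a Schur partition into pairs {a, a + 3} and
-- unpaired parts.  Move every pair down by 3, every unpaired odd part by 2 and
-- every unpaired even part by 4, starting from the smallest; a pair then
-- changes from (odd, even) to (even, odd) or vice versa, its residue mod 3 is
-- kept, and upper pairs become lower pairs.  The only conflict arises when an
-- even part comes to lie 3 above an unpaired odd part, possibly with a run of
-- pairs in between at distances 3: then the two exchange their roles, the odd
-- one becoming the larger, with the sum and all pairs unchanged, and the even
-- part moves on down in this way as long as it can.

module Submission where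

open import Defs
open import Data.Empty using (⊥; ⊥-elim)
import Data.Integer.Properties as ℤ
open import Data.List using (List; []; _∷_; _++_; length)
open import Data.List.Membership.Propositional using (_∈_)
open import Data.List.Membership.Propositional.Properties using (∈-++⁺ʳ; ∈-++⁺ˡ; ∈-++⁻)
open import Data.List.Properties using (∷-injective; ∷-injectiveʳ)
open import Data.List.Relation.Binary.Sublist.Propositional using (_⊆_; []; _∷_; _∷ʳ_; lookup; ⊆-refl)
open import Data.List.Relation.Binary.Sublist.Propositional.Properties using (++⁺)
open import Data.List.Relation.Unary.All as All using (All; []; _∷_)
open import Data.List.Relation.Unary.AllPairs as AllPairs using (AllPairs; []; _∷_)
open import Data.List.Relation.Unary.Any using (here; there)
open import Data.List.Relation.Unary.Linked as Linked using (Linked; []; [-]; _∷_)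
open import Data.List.Relation.Unary.Linked.Properties using (Linked⇒AllPairs)
open import Data.Nat using (ℕ; zero; suc; _+_; _*_; _≤_; _<_; _%_; z≤n; s≤s; parity; _≟_; _<?_)
open import Data.Nat.Divisibility using (m%n≡0⇒n∣m; n∣m⇒m%n≡0)
open import Data.Nat.ListAction using (sum)
open import Data.Nat.Properties hiding (_≟_; _<?_)
open import Data.Nat.Tactic.RingSolver using (solve-∀)
open import Data.Parity.Base using (Parity; 0ℙ; 1ℙ; _⁻¹)
open import Data.Parity.Properties as ℙ using (suc-homo-⁻¹; p≢p⁻¹; ⁻¹-involutive)
open import Data.Product using (∃; _×_; _,_; proj₁; proj₂; map₁)
open import Data.Sum using (_⊎_; inj₁; inj₂)
open import Data.Unit using (⊤; tt)
open import Function.Base using (_∘_; id)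
open import Function.Bundles using (Bijection; _⇔_; mk⇔; Equivalence)
open import Relation.Nullary using (¬_; Dec; yes; no)
open import Relation.Binary.PropositionalEquality

open Equivalence using () renaming (to to ⇒; from to ⇐)
open import Algebra.Properties.AbelianGroup ℤ.+-0-abelianGroup using (//-rightDividesˡ; //-rightDividesʳ)

-- The 6 that a pair loses is 2 for its odd part and 4 for its even part, whence `2 * (ω + 2 * ε)`.
-- Apart from the part 1, lower pairs are upper pairs with the parities interchanged, so one grammar
-- of words, with parameter `c`, serves both sides; source partitions do not contain 1. The obstacle
-- to inverting the map is that an unpaired odd part `D (suc s)` of the image may be an old odd part
-- (`lowC`) or the upper end of an exchange (`shift`). The source tail decides: if `C (3 + s)` would
-- stand on a `Chain` there, the part cannot come from an unpaired odd one, and precisely then the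
-- image tail is the result of an exchange that can be undone.

-- Parts are grouped relative to a parity c (odd for upper pairs, even for
-- lower pairs): C t is an unpaired part of parity c and D x an unpaired part
-- of the other parity, while P a and Q a are pairs {a, a + 3} with a of parity
-- c and of the other parity, respectively.  Words, like partitions, list the
-- largest parts first.
data Unit : Set where
  C D P Q : ℕ → Unit

Word : Set
Word = List Unit

parts : Unit → List ℕ
parts (C x) = x ∷ []
parts (D x) = x ∷ []
parts (P a) = 3 + a ∷ a ∷ []
parts (Q a) = 3 + a ∷ a ∷ []

flat : Word → List ℕ
flat [] = []
flat (u ∷ w) = parts u ++ flat w

-- A unit can be put on top of u as soon as its least part is at least
-- 3 + base u (C, P) or 4 + base u (D, Q), apart from Q-chains and Chain below.
base : Unit → ℕ
base (C x) = 1 + x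
base (D x) = x
base (P a) = 3 + a
base (Q a) = 4 + a

Above : ℕ → Word → ℕ → Set
Above k [] n = ⊤
Above k (u ∷ _) n = k + base u ≤ n

-- Chain t w: an unpaired C t on w would be the top of an even progression
-- D P … P C, so its parts would all be paired.  A part 1 is never in a lower
-- pair, whence 1 < x.
data Chain : ℕ → Word → Set where
  here : ∀ {x w} → 1 < x → Chain (3 + x) (D x ∷ w)
  skip : ∀ {a w} → Chain a w → Chain (6 + a) (P a ∷ w)

-- The larger bound for `D` and `Q` rules out contacts that would regroup the parts below: a `D`
-- exactly 3 above a `C` makes a `P` with it, and 3 above a `Q` it turns the run of `Q`s into `P`s
-- over a `D`. Contact between two `Q`s is let back in by `fitQQ`; the opposite regrouping is barred
-- by `¬ Chain` in `fitC`.
data Fits : Unit → Word → Set where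
  fitC  : ∀ {t w} → Above 3 w t → ¬ Chain t w → Fits (C t) w
  fitD  : ∀ {x w} → Above 4 w x → Fits (D x) w
  fitP  : ∀ {a w} → Above 3 w a → Fits (P a) w
  fitQ  : ∀ {a w} → Above 4 w a → Fits (Q a) w
  fitQQ : ∀ {a w} → Fits (Q (6 + a)) (Q a ∷ w)

-- The part 1 may occur only as a `D`. Two multiples of 3 cannot be 3 apart in a Schur partition, so
-- no member of a pair is divisible by 3.
Shape : Parity → Unit → Set
Shape c (C t) = parity t ≡ c × 1 < t
Shape c (D x) = parity x ≡ c ⁻¹ × 0 < x
Shape c (P a) = parity a ≡ c × 1 < a × ¬ (a % 3 ≡ 0)
Shape c (Q a) = parity a ≡ c ⁻¹ × 1 < a × ¬ (a % 3 ≡ 0)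

data Valid (c : Parity) : Word → Set where
  []  : Valid c []
  add : ∀ {u w} → Fits u w → Shape c u → Valid c w → Valid c (u ∷ w)

parity-suc : ∀ {p} n → parity n ≡ p → parity (suc n) ≡ p ⁻¹
parity-suc n refl = trans (sym (⁻¹-involutive _)) (cong _⁻¹ (suc-homo-⁻¹ n))

parity-pred : ∀ {p} n → parity (suc n) ≡ p ⁻¹ → parity n ≡ p
parity-pred {p} n e = trans (sym (suc-homo-⁻¹ n)) (trans (cong _⁻¹ e) (⁻¹-involutive p))

parity-clash : ∀ {c} n → parity n ≡ c → parity n ≡ c ⁻¹ → ⊥
parity-clash {c} n refl e = p≢p⁻¹ c e

≤-pred3 : ∀ {m n} → 3 + m ≤ 3 + n → m ≤ n
≤-pred3 (s≤s (s≤s (s≤s h))) = h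

chain? : ∀ t w → Dec (Chain t w)
chain? t [] = no λ ()
chain? t (C x ∷ w) = no λ ()
chain? t (Q x ∷ w) = no λ ()
chain? t (D x ∷ w) with t ≟ 3 + x | 1 <? x
... | yes refl | yes 1<x = yes (here 1<x)
... | yes _ | no ≮ = no λ { (here h) → ≮ h }
... | no ≢ | _ = no λ { (here h) → ≢ refl }
chain? t (P a ∷ w) with t ≟ 6 + a
... | no ≢ = no λ { (skip _) → ≢ refl }
... | yes refl with chain? a w
...   | yes h = yes (skip h)
...   | no ¬h = no λ { (skip h) → ¬h h }

-- The exchange of an even part with odd parts below it

-- A part t of parity c (an even part, below) that would sit 3 above v, at the
-- top of a chain, is exchanged with the lowest unpaired odd part 1 + x that it
-- reaches through contiguous P's and D's: t becomes 1 + t and 1 + x becomes x,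
-- no other part moves.
data Shift : ℕ → Word → Word → Set where
  throughP : ∀ {a v v′} → Shift a v v′ → Shift (6 + a) (P a ∷ v) (P a ∷ v′)
  throughD : ∀ {x v v′} → Shift x v v′ → Shift (4 + x) (D (suc x) ∷ v) (D (suc x) ∷ v′)
  settle   : ∀ {x v} → 0 < x → ¬ Chain x v → Shift (4 + x) (D (suc x) ∷ v) (C x ∷ v)

shift-pos : ∀ {t v v′} → Shift t v v′ → 0 < t
shift-pos (throughP s) = s≤s z≤n
shift-pos (throughD s) = s≤s z≤n
shift-pos (settle _ _) = s≤s z≤n

-- An exchange is possible exactly where `fitC` forbids an unpaired part, so lowering never gets
-- stuck; the bound `1 < 1 + x` carried by the chain keeps the settled part `x` positive.
chain→shift : ∀ {t} v → Chain t v → ∃ λ v′ → Shift t v v′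
chain→shift (P a ∷ v) (skip h) with chain→shift v h
... | _ , s = _ , throughP s
chain→shift (D (suc x) ∷ v) (here (s≤s 0<x)) with chain? x v
... | no ¬h = _ , settle 0<x ¬h
... | yes h with chain→shift v h
...   | _ , s = _ , throughD s

shift→chain : ∀ {t v v′} → Shift t v v′ → Chain t v
shift→chain (throughP s) = skip (shift→chain s)
shift→chain (throughD s) = here (s≤s (shift-pos s))
shift→chain (settle 0<x _) = here (s≤s 0<x)

-- `settle` requires that the even part can go no further, so the stopping place is forced.
shift-functional : ∀ {t v v₁ v₂} → Shift t v v₁ → Shift t v v₂ → v₁ ≡ v₂
shift-functional (throughP s) (throughP s′) = cong (_ ∷_) (shift-functional s s′)
shift-functional (throughD s) (throughD s′) = cong (_ ∷_) (shift-functional s s′)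
shift-functional (throughD s) (settle _ ¬h) = ⊥-elim (¬h (shift→chain s))
shift-functional (settle _ ¬h) (throughD s) = ⊥-elim (¬h (shift→chain s))
shift-functional (settle _ _) (settle _ _) = refl

shift-injective : ∀ {t v₁ v₂ v} → Shift t v₁ v → Shift t v₂ v → v₁ ≡ v₂
shift-injective (throughP s) (throughP s′) = cong (_ ∷_) (shift-injective s s′)
shift-injective (throughD s) (throughD s′) = cong (_ ∷_) (shift-injective s s′)
shift-injective (settle _ _) (settle _ _) = refl

above-weaken : ∀ k w {n} → Above (suc k) w (suc n) → Above k w n
above-weaken k [] _ = tt
above-weaken k (u ∷ w) (s≤s h) = h

above-strengthen : ∀ k w {n} → Above k w n → Above (suc k) w (suc n)
above-strengthen k [] _ = tt
above-strengthen k (u ∷ w) h = s≤s h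

-- The parts are in contact, so the bound is an equality; since `D (suc x)` and `C x` have the same
-- `base`, the exchange leaves the room for units above unchanged.
shift-above-source : ∀ {t v v′} → Shift t v v′ → Above 3 v t
shift-above-source (throughP s) = ≤-refl
shift-above-source (throughD s) = ≤-refl
shift-above-source (settle _ _) = ≤-refl

shift-above-target : ∀ {t v v′} → Shift t v v′ → Above 3 v′ t
shift-above-target (throughP s) = ≤-refl
shift-above-target (throughD s) = ≤-refl
shift-above-target (settle _ _) = ≤-refl

even>1 : ∀ {x} → 0 < x → parity x ≡ 0ℙ → 1 < x
even>1 {suc (suc x)} _ _ = s≤s (s≤s z≤n)

shift-valid : ∀ {t v v′} → Shift t v v′ → Valid 0ℙ v → Valid 0ℙ v′
shift-valid (throughP s) (add _ sh va) =
  add (fitP (shift-above-target s)) sh (shift-valid s va)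
shift-valid (throughD s) (add _ sh va) =
  add (fitD (above-strengthen 3 _ (shift-above-target s))) sh (shift-valid s va)
shift-valid {v = _ ∷ v} (settle {x} 0<x ¬h) (add (fitD ab) (e , _) va) =
  add (fitC (above-weaken 3 v ab) ¬h) (parity-pred x e , even>1 0<x (parity-pred x e)) va

unshift-valid : ∀ {t v v′} → Shift t v v′ → Valid 0ℙ v′ → Valid 0ℙ v
unshift-valid (throughP s) (add _ sh va) =
  add (fitP (shift-above-source s)) sh (unshift-valid s va)
unshift-valid (throughD s) (add _ sh va) =
  add (fitD (above-strengthen 3 _ (shift-above-source s))) sh (unshift-valid s va)
unshift-valid {v = _ ∷ v} (settle {x} 0<x ¬h) (add (fitC ab _) (e , _) va) =
  add (fitD (above-strengthen 3 v ab)) (parity-suc x e , s≤s z≤n) va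

shift-length : ∀ {t v v′} → Shift t v v′ → length v ≡ length v′
shift-length (throughP s) = cong suc (shift-length s)
shift-length (throughD s) = cong suc (shift-length s)
shift-length (settle _ _) = refl

-- The lowering map and its inverse

-- Source words have c odd, target words have c even.
data Lower : Word → Word → Set where
  []    : Lower [] []
  lowC  : ∀ {s w v} → Lower w v → Lower (C (2 + s) ∷ w) (D s ∷ v)
  lowP  : ∀ {a w v} → Lower w v → Lower (P (3 + a) ∷ w) (P a ∷ v)
  lowQ  : ∀ {a w v} → Lower w v → Lower (Q (3 + a) ∷ w) (Q a ∷ v)
  lowD  : ∀ {t w v} → Lower w v → ¬ Chain t v → Lower (D (4 + t) ∷ w) (C t ∷ v)
  shift : ∀ {t w v v′} → Lower w v → Shift t v v′ → Lower (D (4 + t) ∷ w) (D (suc t) ∷ v′)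

+-3+ : ∀ k b → k + (3 + b) ≡ 3 + (k + b)
+-3+ k b = trans (+-suc k (2 + b)) (cong suc (trans (+-suc k (suc b)) (cong suc (+-suc k b))))

cancel3 : ∀ k b {n} → k + (3 + b) ≤ 3 + n → k + b ≤ n
cancel3 k b h = ≤-pred3 (≤-trans (≤-reflexive (sym (+-3+ k b))) h)

insert3 : ∀ k b {n} → k + b ≤ n → k + (3 + b) ≤ 3 + n
insert3 k b h = ≤-trans (≤-reflexive (+-3+ k b)) (s≤s (s≤s (s≤s h)))

-- Each clause of `Lower` reduces the `base` of the head by exactly 3, an exchange included. An
-- unpaired part sinks by 2 or 4 instead, and the difference of one is what separates the bounds in
-- `fitC` and `fitD`.
lower-above : ∀ k {w v n} → Lower w v → Above k w (3 + n) → Above k v n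
lower-above k [] _ = tt
lower-above k (lowC _) h = cancel3 k _ h
lower-above k (lowP _) h = cancel3 k _ h
lower-above k (lowQ _) h = cancel3 k _ h
lower-above k (lowD _ _) h = cancel3 k _ h
lower-above k (shift _ _) h = cancel3 k _ h

raise-above : ∀ k {w v n} → Lower w v → Above k v n → Above k w (3 + n)
raise-above k [] _ = tt
raise-above k (lowC _) h = insert3 k _ h
raise-above k (lowP _) h = insert3 k _ h
raise-above k (lowQ _) h = insert3 k _ h
raise-above k (lowD _ _) h = insert3 k _ h
raise-above k (shift _ _) h = insert3 k _ h

parity⇒odd : ∀ x → parity x ≡ 1ℙ → IsOdd x
parity⇒odd (suc zero) _ = refl
parity⇒odd (suc (suc x)) e = parity⇒odd x e

odd⇒parity : ∀ x → IsOdd x → parity x ≡ 1ℙ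
odd⇒parity (suc zero) _ = refl
odd⇒parity (suc (suc x)) e = odd⇒parity x e

parity⇒even : ∀ x → parity x ≡ 0ℙ → IsEven x
parity⇒even zero _ = refl
parity⇒even (suc (suc x)) e = parity⇒even x e

even⇒parity : ∀ x → IsEven x → parity x ≡ 0ℙ
even⇒parity zero _ = refl
even⇒parity (suc (suc x)) e = even⇒parity x e

RestrictedPart : ℕ → Set
RestrictedPart x = (IsOdd x → 3 ≤ x) × (IsEven x → 6 ≤ x)

-- The restriction leaves just enough room: odd parts from 3 on land on at least 1, even parts from
-- 6 on at least 2, and the odd lower member of a pair is not 3, hence at least 5 and lands on at
-- least 2.
lower-total : ∀ {w} → Valid 1ℙ w → Restricted (flat w) → ∃ λ v → Lower w v × Valid 0ℙ v
lower-total [] _ = _ , [] , []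
lower-total (add {C t} {w} (fitC ab _) (e , _) va) (r ∷ rs)
  with m≤n⇒∃[o]m+o≡n (proj₁ r (parity⇒odd t e)) | lower-total va rs
... | s , refl | v , l , vv =
  _ , lowC l , add (fitD (lower-above 4 l (above-strengthen 3 w ab))) (e , s≤s z≤n) vv
lower-total (add {D t} {w} (fitD ab) (e , _) va) (r ∷ rs)
  with m≤n⇒∃[o]m+o≡n (proj₂ r (parity⇒even t e)) | lower-total va rs
... | t₁ , refl | v , l , vv with chain? (2 + t₁) v
...   | no ¬h = _ , lowD l ¬h ,
        add (fitC (above-weaken 3 v (lower-above 4 l ab)) ¬h) (e , s≤s (s≤s z≤n)) vv
...   | yes h with chain→shift v h
...     | v′ , s = _ , shift l s ,
          add (fitD (above-strengthen 3 v′ (shift-above-target s)))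
              (parity-suc t₁ e , s≤s z≤n) (shift-valid s vv)
lower-total (add {P a} (fitP ab) (e , 1<a , a≢0) va) (_ ∷ r ∷ rs)
  with m≤n⇒∃[o]m+o≡n (proj₁ r (parity⇒odd a e)) | lower-total va rs
... | a′ , refl | v , l , vv =
  _ , lowP l , add (fitP (lower-above 3 l ab)) (parity-pred a′ e , positive a′ a≢0 e , a≢0) vv
  where
  positive : ∀ a → ¬ (a % 3 ≡ 0) → parity (suc a) ≡ 1ℙ → 1 < a
  positive zero n _ = ⊥-elim (n refl)
  positive (suc (suc a)) _ _ = s≤s (s≤s z≤n)
lower-total (add {Q a} {w} f (e , 1<a , a≢0) va) (_ ∷ r ∷ rs)
  with m≤n⇒∃[o]m+o≡n (proj₂ r (parity⇒even a e)) | lower-total va rs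
... | a″ , refl | v , l , vv =
  _ , lowQ l , add (fits f l) (parity-pred (3 + a″) e , s≤s (s≤s z≤n) , a≢0) vv
  where
  fits : ∀ {a v} → Fits (Q (3 + a)) w → Lower w v → Fits (Q a) v
  fits (fitQ h) l = fitQ (lower-above 4 l h)
  fits fitQQ (lowQ _) = fitQQ

lower-functional : ∀ {w v₁ v₂} → Lower w v₁ → Lower w v₂ → v₁ ≡ v₂
lower-functional [] [] = refl
lower-functional (lowC l) (lowC l′) = cong (_ ∷_) (lower-functional l l′)
lower-functional (lowP l) (lowP l′) = cong (_ ∷_) (lower-functional l l′)
lower-functional (lowQ l) (lowQ l′) = cong (_ ∷_) (lower-functional l l′)
lower-functional (lowD l ¬h) l₂ with l₂
... | lowD l′ _ = cong (_ ∷_) (lower-functional l l′)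
... | shift l′ s rewrite lower-functional l l′ = ⊥-elim (¬h (shift→chain s))
lower-functional (shift l s) l₂ with l₂
... | lowD l′ ¬h rewrite lower-functional l l′ = ⊥-elim (¬h (shift→chain s))
... | shift l′ s′ rewrite lower-functional l l′ = cong (_ ∷_) (shift-functional s s′)

-- This separates a D created by shift from one created by lowC.
lower-chain : ∀ {t w u v} → Valid 1ℙ w → Lower w v → Shift t u v → Chain (3 + t) w
lower-chain (add _ _ va) (lowP l) (throughP s) = skip (lower-chain va l s)
lower-chain (add (fitC _ ¬h) _ va) (lowC l) (throughD s) = ⊥-elim (¬h (lower-chain va l s))
lower-chain (add _ _ va) (shift l s′) (throughD s) = here (s≤s (s≤s z≤n))
lower-chain (add _ _ va) (lowD l _) (settle _ _) = here (s≤s (s≤s z≤n))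

lower-injective : ∀ {w₁ w₂ v} → Valid 1ℙ w₁ → Valid 1ℙ w₂ → Lower w₁ v → Lower w₂ v → w₁ ≡ w₂
lower-injective _ _ [] [] = refl
lower-injective (add _ _ v₁) (add _ _ v₂) (lowC l) (lowC l′) = cong (_ ∷_) (lower-injective v₁ v₂ l l′)
lower-injective (add _ _ v₁) (add _ _ v₂) (lowP l) (lowP l′) = cong (_ ∷_) (lower-injective v₁ v₂ l l′)
lower-injective (add _ _ v₁) (add _ _ v₂) (lowQ l) (lowQ l′) = cong (_ ∷_) (lower-injective v₁ v₂ l l′)
lower-injective (add _ _ v₁) (add _ _ v₂) (lowD l _) (lowD l′ _) = cong (_ ∷_) (lower-injective v₁ v₂ l l′)
lower-injective (add (fitC _ ¬h) _ v₁) _ (lowC l) (shift l′ s) = ⊥-elim (¬h (lower-chain v₁ l s))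
lower-injective _ (add (fitC _ ¬h) _ v₂) (shift l s) (lowC l′) = ⊥-elim (¬h (lower-chain v₂ l′ s))
lower-injective (add _ _ v₁) (add _ _ v₂) (shift l s) (shift l′ s′) with shift-injective s s′
... | refl = cong (_ ∷_) (lower-injective v₁ v₂ l l′)

-- The source `D` at the foot of the chain was lowered either by `lowD`, and is then the even part
-- that settled there, or by `shift`, and then the even part passed through it. Together with
-- `lower-chain` this makes the chain test on the source tail decisive.
chain-lower : ∀ {t w v} → Valid 0ℙ v → Lower w v → Chain (3 + t) w → ∃ λ u → Shift t u v
chain-lower [] [] ()
chain-lower (add _ _ va) (lowP l) (skip h) with chain-lower va l h
... | _ , s = _ , throughP s
chain-lower (add _ (_ , 1<x) _) (lowD l ¬h) (here _) = _ , settle (<-trans (s≤s z≤n) 1<x) ¬h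
chain-lower _ (shift l s) (here _) = _ , throughD s

-- Undoing an exchange replaces the tail by a word that is not a subterm but has the same length,
-- hence the induction on length.
lower-onto : ∀ n {v} → length v ≡ n → Valid 0ℙ v → ∃ λ w → Lower w v × Valid 1ℙ w
lower-onto zero {[]} _ _ = _ , [] , []
lower-onto (suc n) {C t ∷ v} e (add (fitC ab ¬h) (p , _) va) with lower-onto n (suc-injective e) va
... | w , l , wv = _ , lowD l ¬h ,
  add (fitD (raise-above 4 l (above-strengthen 3 v ab))) (p , s≤s z≤n) wv
lower-onto (suc n) {P a ∷ v} e (add (fitP ab) (p , 1<a , a≢0) va) with lower-onto n (suc-injective e) va
... | w , l , wv = _ , lowP l ,
  add (fitP (raise-above 3 l ab)) (parity-suc a p , s≤s (s≤s z≤n) , a≢0) wv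
lower-onto (suc n) {Q a ∷ v} e (add f (p , 1<a , a≢0) va) with lower-onto n (suc-injective e) va
... | w , l , wv = _ , lowQ l , add (fits f l) (parity-suc a p , s≤s (s≤s z≤n) , a≢0) wv
  where
  fits : ∀ {a w} → Fits (Q a) v → Lower w v → Fits (Q (3 + a)) w
  fits (fitQ h) l = fitQ (raise-above 4 l h)
  fits fitQQ (lowQ _) = fitQQ
lower-onto (suc n) {D (suc s) ∷ v} e (add (fitD ab) (p , _) va) with lower-onto n (suc-injective e) va
-- This preimage of the tail serves to choose between the clauses; if the chain is present it is
-- discarded in favour of a preimage of the tail before the exchange.
... | w , l , wv with chain? (3 + s) w
...   | no ¬h = _ , lowC l ,
        add (fitC (above-weaken 3 w (raise-above 4 l ab)) ¬h) (p , s≤s (s≤s z≤n)) wv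
...   | yes h with chain-lower va l h
...     | u , sh with lower-onto n (trans (shift-length sh) (suc-injective e)) (unshift-valid sh va)
...       | w′ , l′ , wv′ = _ , shift l′ sh ,
            add (fitD (raise-above 4 l′ (above-strengthen 3 u (shift-above-source sh))))
                (parity-pred s p , s≤s z≤n) wv′

odd-part : ∀ {x} → parity x ≡ 1ℙ → 3 ≤ x → RestrictedPart x
odd-part {x} e h = (λ _ → h) , λ ev → ⊥-elim (parity-clash x (even⇒parity x ev) e)

even-part : ∀ {x} → parity x ≡ 0ℙ → 6 ≤ x → RestrictedPart x
even-part {x} e h = (λ od → ⊥-elim (parity-clash x e (odd⇒parity x od))) , λ _ → h

lower-restricted : ∀ {w v} → Lower w v → Valid 0ℙ v → Restricted (flat w)
lower-restricted [] [] = []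
lower-restricted (lowC l) (add {u = D s} _ (e , 0<s) vv) =
  odd-part e (s≤s (s≤s 0<s)) ∷ lower-restricted l vv
lower-restricted (lowP l) (add {u = P a} _ (e , 1<a , _) vv) =
  even-part e (+-monoʳ-≤ 6 {x = 0} z≤n) ∷ odd-part (parity-suc a e) (+-monoʳ-≤ 3 {x = 0} z≤n) ∷ lower-restricted l vv
lower-restricted (lowQ l) (add {u = Q a} _ (e , 1<a , _) vv) =
  odd-part e (+-monoʳ-≤ 3 {x = 0} z≤n) ∷ even-part (parity-suc a e) (+-monoʳ-≤ 3 (odd>2 e 1<a)) ∷ lower-restricted l vv
  where
  odd>2 : ∀ {a} → parity a ≡ 1ℙ → 1 < a → 3 ≤ a
  odd>2 {suc (suc (suc a))} _ _ = s≤s (s≤s (s≤s z≤n))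
  odd>2 {suc zero} _ (s≤s ())
lower-restricted (lowD {t} l _) (add _ (e , 1<t) vv) =
  even-part e (+-monoʳ-≤ 4 1<t) ∷ lower-restricted l vv
lower-restricted (shift {t} l s) (add _ (e , _) vv) =
  even-part (parity-pred t e) (+-monoʳ-≤ 4 (even>1 (shift-pos s) (parity-pred t e)))
  ∷ lower-restricted l (unshift-valid s vv)

-- Statistics preserved by lowering

-- Parts are counted, not units: a pair contributes one part of parity `c` and one of the other. As
-- `c` is odd in the source and even in the target, the two counts trade places under lowering.
#c #d : Word → ℕ
#c [] = 0
#c (C _ ∷ w) = suc (#c w)
#c (D _ ∷ w) = #c w
#c (P _ ∷ w) = suc (#c w)
#c (Q _ ∷ w) = suc (#c w)
#d [] = 0
#d (C _ ∷ w) = #d w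
#d (D _ ∷ w) = suc (#d w)
#d (P _ ∷ w) = suc (#d w)
#d (Q _ ∷ w) = suc (#d w)

keepIf : {A : Set} → Dec A → List ℕ → List ℕ
keepIf (yes _) xs = xs
keepIf (no _) _ = []

pairedParts : ℕ → ℕ → List ℕ
pairedParts r a = keepIf (a % 3 ≟ r) (3 + a ∷ a ∷ [])

paired : ℕ → Word → List ℕ
paired r [] = []
paired r (C _ ∷ w) = paired r w
paired r (D _ ∷ w) = paired r w
paired r (P a ∷ w) = pairedParts r a ++ paired r w
paired r (Q a ∷ w) = pairedParts r a ++ paired r w

shift-#c : ∀ {t v v′} → Shift t v v′ → #c v′ ≡ suc (#c v)
shift-#c (throughP s) = cong suc (shift-#c s)
shift-#c (throughD s) = shift-#c s
shift-#c (settle _ _) = refl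

shift-#d : ∀ {t v v′} → Shift t v v′ → #d v ≡ suc (#d v′)
shift-#d (throughP s) = cong suc (shift-#d s)
shift-#d (throughD s) = cong suc (shift-#d s)
shift-#d (settle _ _) = refl

shift-paired : ∀ {t v v′} r → Shift t v v′ → paired r v ≡ paired r v′
shift-paired r (throughP {a} s) = cong (pairedParts r a ++_) (shift-paired r s)
shift-paired r (throughD s) = shift-paired r s
shift-paired r (settle _ _) = refl

shift-sum : ∀ {t v v′} → Shift t v v′ → sum (flat v) ≡ suc (sum (flat v′))
shift-sum (throughP {a} s) rewrite shift-sum s =
  trans (cong (λ k → 3 + a + k) (+-suc a _)) (+-suc (3 + a) _)
shift-sum (throughD {x} s) rewrite shift-sum s = +-suc (suc x) _
shift-sum (settle _ _) = refl

lower-#c : ∀ {w v} → Lower w v → #c w ≡ #d v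
lower-#c [] = refl
lower-#c (lowC l) = cong suc (lower-#c l)
lower-#c (lowP l) = cong suc (lower-#c l)
lower-#c (lowQ l) = cong suc (lower-#c l)
lower-#c (lowD l _) = lower-#c l
lower-#c (shift l s) = trans (lower-#c l) (shift-#d s)

lower-#d : ∀ {w v} → Lower w v → #d w ≡ #c v
lower-#d [] = refl
lower-#d (lowC l) = lower-#d l
lower-#d (lowP l) = cong suc (lower-#d l)
lower-#d (lowQ l) = cong suc (lower-#d l)
lower-#d (lowD l _) = cong suc (lower-#d l)
lower-#d (shift l s) = trans (cong suc (lower-#d l)) (sym (shift-#c s))

lower-paired : ∀ {w v} r → Lower w v → length (paired r w) ≡ length (paired r v)
lower-pair : ∀ {w v} r a → Lower w v →
  length (pairedParts r (3 + a) ++ paired r w) ≡ length (pairedParts r a ++ paired r v)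
-- `(3 + a) % 3` reduces to `a % 3`, so one case split decides both sides.
lower-pair r a l with a % 3 ≟ r
... | yes _ = cong (2 +_) (lower-paired r l)
... | no _ = lower-paired r l
lower-paired r [] = refl
lower-paired r (lowC l) = lower-paired r l
lower-paired r (lowP {a} l) = lower-pair r a l
lower-paired r (lowQ {a} l) = lower-pair r a l
lower-paired r (lowD l _) = lower-paired r l
lower-paired r (shift l s) = trans (lower-paired r l) (cong length (shift-paired r s))

-- In the exchange case the head loses only 3, from `4 + t` to `1 + t`; the missing 1 is lost in the
-- tail, by `shift-sum`.
lower-sum : ∀ {w v} → Lower w v → sum (flat w) ≡ sum (flat v) + 2 * (#d v + 2 * #c v)
lower-sum [] = refl
lower-sum {v = D s ∷ v} (lowC l) rewrite lower-sum l = lem s (sum (flat v)) (#d v) (#c v)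
  where
  lem : ∀ s S d c → 2 + s + (S + 2 * (d + 2 * c)) ≡ s + S + 2 * (suc d + 2 * c)
  lem = solve-∀
lower-sum {v = P a ∷ v} (lowP l) rewrite lower-sum l = lem a (sum (flat v)) (#d v) (#c v)
  where
  lem : ∀ a S d c → 6 + a + (3 + a + (S + 2 * (d + 2 * c)))
                  ≡ 3 + a + (a + S) + 2 * (suc d + 2 * suc c)
  lem = solve-∀
lower-sum {v = Q a ∷ v} (lowQ l) rewrite lower-sum l = lem a (sum (flat v)) (#d v) (#c v)
  where
  lem : ∀ a S d c → 6 + a + (3 + a + (S + 2 * (d + 2 * c)))
                  ≡ 3 + a + (a + S) + 2 * (suc d + 2 * suc c)
  lem = solve-∀
lower-sum {v = C t ∷ v} (lowD l _) rewrite lower-sum l = lem t (sum (flat v)) (#d v) (#c v)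
  where
  lem : ∀ t S d c → 4 + t + (S + 2 * (d + 2 * c)) ≡ t + S + 2 * (d + 2 * suc c)
  lem = solve-∀
lower-sum {v = D _ ∷ v′} (shift {t} {v = v} l s)
  rewrite lower-sum l | shift-sum s | shift-#d s | shift-#c s =
  lem t (sum (flat v′)) (#d v′) (#c v)
  where
  lem : ∀ t S d c → 4 + t + (suc S + 2 * (suc d + 2 * c)) ≡ suc t + S + 2 * (suc d + 2 * suc c)
  lem = solve-∀

-- Decomposition of a Schur partition

parity-suc⁻¹ : ∀ {c} n → parity n ≡ c ⁻¹ → parity (suc n) ≡ c
parity-suc⁻¹ {c} n e = trans (parity-suc n e) (⁻¹-involutive c)

other-parity : ∀ {c} p → ¬ (p ≡ c) → p ≡ c ⁻¹
other-parity {0ℙ} 0ℙ ≢ = ⊥-elim (≢ refl)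
other-parity {0ℙ} 1ℙ _ = refl
other-parity {1ℙ} 0ℙ _ = refl
other-parity {1ℙ} 1ℙ ≢ = ⊥-elim (≢ refl)

-- Parity rounds gaps up: the least distance could only be attained by a part of the wrong parity.
-- This turns the Schur condition into the bounds of `Fits`.
widen-gap : ∀ {c} k {x y} → parity x ≡ c → parity (k + y) ≡ c ⁻¹ → k + y ≤ x → suc k + y ≤ x
widen-gap k {x} {y} p q h = ≤∧≢⇒< h λ { refl → parity-clash (k + y) p q }

widen-gap′ : ∀ {c} k {x y} → parity x ≡ c ⁻¹ → parity (k + y) ≡ c → k + y ≤ x → suc k + y ≤ x
widen-gap′ k {x} {y} p q h = ≤∧≢⇒< h λ { refl → parity-clash (k + y) q p }

gap-size : ∀ {x y} → SchurGap x y → 3 + y ≤ x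
gap-size {x} {y} (h , _) = subst (_≤ x) (+-comm y 3) h

tight-residue : ∀ {y} → SchurGap (3 + y) y → ¬ (y % 3 ≡ 0)
tight-residue {y} (_ , n) e = n (+-comm 3 y , m%n≡0⇒n∣m (3 + y) 3 e , m%n≡0⇒n∣m y 3 e)

-- The new top part makes the length of `P` ... `P` `D` even, so every bracket slips by one place
-- and the odd one out at the bottom is absorbed.
chain→Q : ∀ {c x w} → Valid c w → Chain x w → parity x ≡ c → ¬ (x % 3 ≡ 0) →
  ∃ λ a → ∃ λ w′ → (x ≡ 3 + a) × Valid c (Q a ∷ w′) × flat (Q a ∷ w′) ≡ x ∷ flat w
chain→Q (add (fitD h) (e , _) va) (here {y} 1<y) _ r =
  y , _ , refl , add (fitQ h) (e , 1<y , r) va , refl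
chain→Q {w = P a ∷ w} (add _ (e , _ , r′) va) (skip h) _ _ with chain→Q va h e r′
... | a′ , w′ , refl , va′ , eq =
  3 + a , Q a′ ∷ w′ , refl ,
  add fitQQ (parity-suc (suc (suc a)) e , s≤s (s≤s z≤n) , r′) va′ ,
  cong (λ l → 6 + a ∷ 3 + a ∷ l) eq

-- The reverse slip: the length becomes odd, and the bottom of the run of `Q`s is left over as a
-- `D`.
Q→P : ∀ {c a w} → Valid c (Q a ∷ w) →
  ∃ λ w′ → Valid c (P (3 + a) ∷ w′) × flat (P (3 + a) ∷ w′) ≡ 6 + a ∷ flat (Q a ∷ w)
Q→P {a = a} {w} (add (fitQ h) (e , 1<a , r) va) =
  D a ∷ w ,
  add (fitP ≤-refl) (parity-suc⁻¹ a e , s≤s (s≤s z≤n) , r)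
    (add (fitD h) (e , <-trans (s≤s z≤n) 1<a) va) ,
  refl
Q→P {a = a} (add fitQQ (e , 1<a , r) va) with Q→P va
... | w′ , va′ , eq =
  _ , add (fitP ≤-refl) (parity-suc⁻¹ a e , s≤s (s≤s z≤n) , r) va′ , cong (λ l → 6 + a ∷ 3 + a ∷ l) eq

-- A new largest part can change the decomposition of the whole progression it
-- extends, by chain→Q or Q→P.
push : ∀ {c x} w → Valid c w → Linked SchurGap (x ∷ flat w) → 0 < x → (parity x ≡ c → 1 < x) →
  ∃ λ w′ → Valid c w′ × flat w′ ≡ x ∷ flat w
push {c} {x} w va lk 0<x 1<x with parity x ℙ.≟ c
... | yes p with chain? x w
...   | no ¬h = C x ∷ w , add (fitC (above w va lk) ¬h) (p , 1<x p) va , refl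
  where
  above : ∀ w → Valid c w → Linked SchurGap (x ∷ flat w) → Above 3 w x
  above [] _ _ = tt
  above (C y ∷ w) (add _ (e , _) _) (g ∷ _) =
    widen-gap 3 p (parity-suc y e) (gap-size g)
  above (D y ∷ w) _ (g ∷ _) = gap-size g
  above (P a ∷ w) _ (g ∷ _) = gap-size g
  above (Q a ∷ w) (add _ (e , _) _) (g ∷ _) = widen-gap 6 p e (gap-size g)
...   | yes h with chain→Q va h p (residue va h lk)
  where
  residue : ∀ {x w} → Valid c w → Chain x w → Linked SchurGap (x ∷ flat w) → ¬ (x % 3 ≡ 0)
  residue _ (here _) (g ∷ _) = tight-residue g
  residue (add _ (_ , _ , r) _) (skip _) _ = r
...     | a , w′ , refl , va′ , eq = Q a ∷ w′ , va′ , eq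
push {c} {x} w va lk 0<x 1<x | no ¬p = go w va lk
  where
  p : parity x ≡ c ⁻¹
  p = other-parity (parity x) ¬p
  single : ∀ {w} → Valid c w → Above 4 w x → ∃ λ w′ → Valid c w′ × flat w′ ≡ x ∷ flat w
  single {w} va h = D x ∷ w , add (fitD h) (p , 0<x) va , refl
  go : ∀ w → Valid c w → Linked SchurGap (x ∷ flat w) → ∃ λ w′ → Valid c w′ × flat w′ ≡ x ∷ flat w
  go [] va _ = single va tt
  go (D y ∷ w) va@(add _ (e , _) _) (g ∷ _) =
    single va (widen-gap′ 3 p (parity-suc⁻¹ y e) (gap-size g))
  go (P a ∷ w) va@(add _ (e , _) _) (g ∷ _) = single va (widen-gap′ 6 p e (gap-size g))
  go (C y ∷ w) va@(add (fitC h _) (e , 1<y) va′) (g ∷ _) with 3 + y ≟ x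
  ... | yes refl = P y ∷ w , add (fitP h) (e , 1<y , tight-residue g) va′ , refl
  ... | no ≢ = single va (widen-gap′ 4 p e (≤∧≢⇒< (gap-size g) ≢))
  go (Q a ∷ w) va@(add _ (e , _) _) (g ∷ _) with 6 + a ≟ x
  ... | yes refl with Q→P va
  ...   | w′ , va′ , eq = _ , va′ , eq
  go (Q a ∷ w) va@(add _ (e , _) _) (g ∷ _) | no ≢ =
    single va (widen-gap′ 7 p (parity-suc⁻¹ a e) (≤∧≢⇒< (gap-size g) ≢))

parse : ∀ {c π} → All (λ x → 0 < x × (parity x ≡ c → 1 < x)) π → Linked SchurGap π →
  ∃ λ w → Valid c w × flat w ≡ π
parse [] _ = [] , [] , refl
parse {π = _ ∷ _} ((p , q) ∷ ps) lk with parse ps (Linked.tail lk)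
... | w , va , refl = push w va lk p q

-- Uniqueness of the decomposition

above-top : ∀ k {x l} w {n} → flat w ≡ x ∷ l → Above k w n → k + x ≤ n
above-top k (C y ∷ w) refl h = ≤-trans (+-monoʳ-≤ k (n≤1+n y)) h
above-top k (D y ∷ w) refl h = h
above-top k (P a ∷ w) refl h = h
above-top k (Q a ∷ w) refl h = ≤-trans (+-monoʳ-≤ k (n≤1+n (3 + a))) h

-- Here `3 + a` is read as a `C` on the left and as the top of a `Q` on the right. The brackets then
-- stay off by one place all the way down, `P`s against `Q`s, and this can end only in a `D`: the
-- `C` would have stood on a chain.
single≢Q : ∀ {c a} w₁ {w₂} → Valid c w₁ → Valid c (Q a ∷ w₂) → ¬ Chain (3 + a) w₁ → ¬ (flat w₁ ≡ a ∷ flat w₂)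
single≢Q (C x ∷ w₁) (add _ (e , _) _) (add _ (e′ , _) _) _ eq with ∷-injective eq
... | refl , _ = parity-clash x e e′
single≢Q (D x ∷ w₁) _ (add _ (_ , 1<x , _) _) ¬h eq with ∷-injective eq
... | refl , _ = ¬h (here 1<x)
single≢Q (Q b ∷ w₁) (add _ (e , _) _) (add _ (e′ , _) _) _ eq with ∷-injective eq
... | refl , _ = parity-clash b (parity-suc⁻¹ (suc b) e′) e
single≢Q (P b ∷ w₁) {w₂} (add _ _ va) (add (fitQ h) _ _) ¬h eq with ∷-injective eq
... | refl , eq′ = <-irrefl refl (above-top 4 w₂ (sym eq′) h)
single≢Q (P b ∷ w₁) (add _ _ va) (add fitQQ _ va′) ¬h eq with ∷-injective eq
... | refl , eq′ = single≢Q w₁ va va′ (¬h ∘ skip) (∷-injectiveʳ eq′)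

-- The parity of the top part or the gap demanded by `fitD` settles every clash of heads except `C`
-- against `Q`.
flat-injective : ∀ {c w₁ w₂} → Valid c w₁ → Valid c w₂ → flat w₁ ≡ flat w₂ → w₁ ≡ w₂
flat-injective [] [] _ = refl
flat-injective {w₁ = []} {C _ ∷ _} _ _ ()
flat-injective {w₁ = []} {D _ ∷ _} _ _ ()
flat-injective {w₁ = []} {P _ ∷ _} _ _ ()
flat-injective {w₁ = []} {Q _ ∷ _} _ _ ()
flat-injective {w₁ = C _ ∷ _} {[]} _ _ ()
flat-injective {w₁ = D _ ∷ _} {[]} _ _ ()
flat-injective {w₁ = P _ ∷ _} {[]} _ _ ()
flat-injective {w₁ = Q _ ∷ _} {[]} _ _ ()
flat-injective {w₁ = C _ ∷ _} {C _ ∷ _} (add _ _ v) (add _ _ v′) eq with ∷-injective eq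
... | refl , eq′ = cong (_ ∷_) (flat-injective v v′ eq′)
flat-injective {w₁ = C x ∷ _} {D _ ∷ _} (add _ (p , _) _) (add _ (q , _) _) eq with ∷-injective eq
... | refl , _ = ⊥-elim (parity-clash x p q)
flat-injective {w₁ = C _ ∷ _} {P a ∷ _} (add _ (p , _) _) (add _ (q , _) _) eq with ∷-injective eq
... | refl , _ = ⊥-elim (parity-clash (3 + a) p (parity-suc a q))
flat-injective {w₁ = C _ ∷ w₁} {Q _ ∷ _} (add (fitC _ ¬h) _ v) v′ eq with ∷-injective eq
... | refl , eq′ = ⊥-elim (single≢Q w₁ v v′ ¬h eq′)
flat-injective {w₁ = D x ∷ _} {C _ ∷ _} (add _ (p , _) _) (add _ (q , _) _) eq with ∷-injective eq
... | refl , _ = ⊥-elim (parity-clash x q p)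
flat-injective {w₁ = D _ ∷ _} {D _ ∷ _} (add _ _ v) (add _ _ v′) eq with ∷-injective eq
... | refl , eq′ = cong (_ ∷_) (flat-injective v v′ eq′)
flat-injective {w₁ = D _ ∷ w₁} {P _ ∷ _} (add (fitD h) _ _) _ eq with ∷-injective eq
... | refl , eq′ = ⊥-elim (<-irrefl refl (above-top 4 w₁ eq′ h))
flat-injective {w₁ = D _ ∷ _} {Q a ∷ _} (add _ (p , _) _) (add _ (q , _) _) eq with ∷-injective eq
... | refl , _ = ⊥-elim (parity-clash (3 + a) (parity-suc⁻¹ a q) p)
flat-injective {w₁ = P a ∷ _} {C _ ∷ _} (add _ (p , _) _) (add _ (q , _) _) eq with ∷-injective eq
... | refl , _ = ⊥-elim (parity-clash (3 + a) q (parity-suc a p))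
flat-injective {w₁ = P _ ∷ _} {D _ ∷ w₂} _ (add (fitD h) _ _) eq with ∷-injective eq
... | refl , eq′ = ⊥-elim (<-irrefl refl (above-top 4 w₂ (sym eq′) h))
flat-injective {w₁ = P _ ∷ _} {P _ ∷ _} (add _ _ v) (add _ _ v′) eq with ∷-injective eq
... | refl , eq′ = cong (_ ∷_) (flat-injective v v′ (∷-injectiveʳ eq′))
flat-injective {w₁ = P a ∷ _} {Q _ ∷ _} (add _ (p , _) _) (add _ (q , _) _) eq with ∷-injective eq
... | refl , _ = ⊥-elim (parity-clash a p q)
flat-injective {w₁ = Q _ ∷ _} {C _ ∷ w₂} v (add (fitC _ ¬h) _ v′) eq with ∷-injective eq
... | refl , eq′ = ⊥-elim (single≢Q w₂ v′ v ¬h (sym eq′))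
flat-injective {w₁ = Q a ∷ _} {D _ ∷ _} (add _ (p , _) _) (add _ (q , _) _) eq with ∷-injective eq
... | refl , _ = ⊥-elim (parity-clash (3 + a) (parity-suc⁻¹ a p) q)
flat-injective {w₁ = Q a ∷ _} {P _ ∷ _} (add _ (p , _) _) (add _ (q , _) _) eq with ∷-injective eq
... | refl , _ = ⊥-elim (parity-clash a q p)
flat-injective {w₁ = Q _ ∷ _} {Q _ ∷ _} (add _ _ v) (add _ _ v′) eq with ∷-injective eq
... | refl , eq′ = cong (_ ∷_) (flat-injective v v′ (∷-injectiveʳ eq′))

-- Valid words give Schur partitions

low-gap : ∀ {x y} → ¬ (y % 3 ≡ 0) → 3 + y ≤ x → SchurGap x y
low-gap {x} {y} r h = subst (_≤ x) (+-comm 3 y) h , λ { (_ , _ , d) → r (n∣m⇒m%n≡0 y 3 d) }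

high-gap : ∀ {x y} → ¬ (x % 3 ≡ 0) → 3 + y ≤ x → SchurGap x y
high-gap {x} {y} r h = subst (_≤ x) (+-comm 3 y) h , λ { (_ , d , _) → r (n∣m⇒m%n≡0 x 3 d) }

wide-gap : ∀ {x y} → 4 + y ≤ x → SchurGap x y
wide-gap {x} {y} h = subst (_≤ x) (+-comm 3 y) (<⇒≤ h) ,
  λ { (e , _) → <-irrefl (trans (+-comm 3 y) (sym e)) h }

linked-∷ : ∀ {x l} → (∀ {y l′} → l ≡ y ∷ l′ → SchurGap x y) → Linked SchurGap l → Linked SchurGap (x ∷ l)
linked-∷ {l = []} _ _ = [-]
linked-∷ {l = y ∷ l} g lk = g refl ∷ lk

pair-linked : ∀ {a l} → ¬ (a % 3 ≡ 0) → Linked SchurGap (a ∷ l) → Linked SchurGap (3 + a ∷ a ∷ l)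
pair-linked r lk = low-gap r ≤-refl ∷ lk

valid-linked : ∀ {c w} → Valid c w → Linked SchurGap (flat w)
valid-linked [] = []
valid-linked (add {w = w} (fitP h) (_ , _ , r) va) =
  pair-linked r (linked-∷ (λ e → high-gap r (above-top 3 w e h)) (valid-linked va))
valid-linked (add {w = w} (fitQ h) (_ , _ , r) va) =
  pair-linked r (linked-∷ (λ e → high-gap r (<⇒≤ (above-top 4 w e h))) (valid-linked va))
valid-linked (add fitQQ (_ , _ , r) va) =
  pair-linked r (linked-∷ (λ { refl → high-gap r ≤-refl }) (valid-linked va))
valid-linked (add {w = w} (fitD h) _ va) =
  linked-∷ (λ e → wide-gap (above-top 4 w e h)) (valid-linked va)
valid-linked (add {C t} {w} (fitC h ¬ch) _ va) = linked-∷ (gap w va h ¬ch) (valid-linked va)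
  where
  gap : ∀ {c} w → Valid c w → Above 3 w t → ¬ Chain t w → ∀ {y l} → flat w ≡ y ∷ l → SchurGap t y
  gap (C y ∷ w) _ h _ refl = wide-gap h
  gap (D y ∷ w) (add _ (_ , 0<y) _) h ¬ch refl with t ≟ 3 + y | 1 <? y
  ... | no ≢ | _ = wide-gap (≤∧≢⇒< h (≢ ∘ sym))
  ... | yes refl | yes 1<y = ⊥-elim (¬ch (here 1<y))
  ... | yes refl | no ≮ with ≤-antisym (≮⇒≥ ≮) 0<y
  -- `y` is 1, the only `D` that a `C` may stand exactly 3 above; it is no multiple of 3.
  ...   | refl = low-gap (λ ()) h
  gap (P a ∷ w) (add _ (_ , _ , r) _) h _ refl = low-gap r h
  gap (Q a ∷ w) _ h _ refl = wide-gap h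

valid-positive : ∀ {c w} → Valid c w → All (0 <_) (flat w)
valid-positive [] = []
valid-positive (add {C _} _ (_ , h) va) = <-trans (s≤s z≤n) h ∷ valid-positive va
valid-positive (add {D _} _ (_ , h) va) = h ∷ valid-positive va
valid-positive (add {P _} _ (_ , h , _) va) = s≤s z≤n ∷ <-trans (s≤s z≤n) h ∷ valid-positive va
valid-positive (add {Q _} _ (_ , h , _) va) = s≤s z≤n ∷ <-trans (s≤s z≤n) h ∷ valid-positive va

valid-schur : ∀ {c w} → Valid c w → IsSchur (flat w)
valid-schur va = valid-positive va , valid-linked va

-- Paired parts and maximal progressions

data Paired : Word → ℕ → Set where
  upperP : ∀ {a w} → Paired (P a ∷ w) (3 + a)
  lowerP : ∀ {a w} → Paired (P a ∷ w) a
  upperQ : ∀ {a w} → Paired (Q a ∷ w) (3 + a)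
  lowerQ : ∀ {a w} → Paired (Q a ∷ w) a
  later  : ∀ {u w x} → Paired w x → Paired (u ∷ w) x

linked-max : ∀ {x l z} → Linked SchurGap (x ∷ l) → z ∈ x ∷ l → z ≤ x
linked-max _ (here refl) = ≤-refl
linked-max (g ∷ lk) (there z∈) =
  ≤-trans (linked-max lk z∈) (≤-trans (m≤n+m _ 3) (gap-size g))

above-max : ∀ k {c w n z} → Valid c w → Above k w n → z ∈ flat w → k + z ≤ n
above-max k {w = w} va h z∈ with flat w in eq | valid-linked va
... | x ∷ l | lk = ≤-trans (+-monoʳ-≤ k (linked-max lk z∈)) (above-top k w eq h)

3*suc : ∀ a k → a + 3 * suc k ≡ 3 + (a + 3 * k)
3*suc a k = trans (cong (a +_) (*-suc 3 k)) (+-3+ a (3 * k))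

top bottom : Unit → ℕ
top (C x) = x
top (D x) = x
top (P a) = 3 + a
top (Q a) = 3 + a
bottom (C x) = x
bottom (D x) = x
bottom (P a) = a
bottom (Q a) = a

-- `R` is the set in which progressions are measured: all parts for upper pairs, the parts greater
-- than 1 for lower pairs. Both have the same members above 1 and none below, so one argument covers
-- the two definitions.
module Pairing (c : Parity) (π : List ℕ) (R : ℕ → Set)
  (toR : ∀ {z} → z ∈ π → 1 < z → R z) (fromR : ∀ {z} → R z → z ∈ π × 1 < z) where

  InPair : ℕ → Set
  InPair x = x ∈ π × HasNeighbour π x
    × ¬ (parity x ≡ c × LargestOfOddAP R x)
    × ¬ (parity x ≡ c ⁻¹ × SmallestOfOddAP R x)

  Run : ℕ → ℕ → Set
  Run y L = (∀ i → i < L → y + 3 * i ∈ π) × ¬ (y + 3 * L ∈ π)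

  run-∷ : ∀ {y L} → y ∈ π → Run (3 + y) L → Run y (suc L)
  run-∷ {y} {L} y∈ (f , n) = g , n ∘ subst (_∈ π) (3*suc y L)
    where
    g : ∀ i → i < suc L → y + 3 * i ∈ π
    g zero _ = subst (_∈ π) (sym (+-identityʳ y)) y∈
    g (suc i) (s≤s h) = subst (_∈ π) (sym (3*suc y i)) (f i h)

  run-[] : ∀ {y} → ¬ (y ∈ π) → Run y 0
  run-[] {y} n = (λ _ ()) , n ∘ subst (_∈ π) (+-identityʳ y)

  run-length : ∀ {y L L′} → 1 < y → Run y L → MaxAP R y L′ → L ≡ L′
  run-length {y} {L} {L′} 1<y (f , n) (f′ , _ , n′) = ≤-antisym
    (≮⇒≥ λ h → n′ (toR (f L′ h) (≤-trans 1<y (m≤m+n y _))))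
    (≮⇒≥ λ h → n (proj₁ (fromR (f′ L h))))

  -- The invariant of a walk from the largest part downwards: `w` is what remains, and the parts
  -- already passed are at least `β`.
  record Covers (w : Word) (β : ℕ) : Set where
    constructor _,_
    field
      within  : ∀ {z} → z ∈ flat w → z ∈ π
      covered : ∀ {z} → z ∈ π → z ∈ flat w ⊎ β ≤ z
  open Covers

  -- What the parts above a unit contribute to its membership in pairs.
  Info : Word → Set
  Info [] = ⊤
  Info (C t ∷ w) = ¬ (3 + t ∈ π)
  Info (D x ∷ w) = x ≤ 1 ⊎ ∃ λ L → parity L ≡ 0ℙ × Run (3 + x) L
  Info (P a ∷ w) = ∃ λ L → (parity L ≡ 0ℙ ⊎ ¬ Chain a w) × Run (6 + a) L
  Info (Q a ∷ w) = ∃ λ L → parity L ≡ 0ℙ × Run (6 + a) L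

  absent : ∀ {c w β z} → Valid c w → Covers w β → (∀ {y} → y ∈ flat w → y < z) → z < β → ¬ (z ∈ π)
  absent va (_ , cov) lt h z∈ with cov z∈
  ... | inj₁ z∈w = <-irrefl refl (lt z∈w)
  ... | inj₂ β≤z = <-irrefl refl (<-≤-trans h β≤z)

  top-absent : ∀ {c x l w β} → Valid c w → Covers w β → flat w ≡ x ∷ l → 4 + x ≤ β → ¬ (3 + x ∈ π)
  top-absent {w = w} va cov eq h = absent va cov
    (λ y∈ → s≤s (≤-trans (linked-max (subst (Linked SchurGap) eq (valid-linked va)) (subst (_ ∈_) eq y∈)) (m≤n+m _ 2))) h

  info-gap : ∀ {c} w {β} → Valid c w → Covers w β → Above 4 w β → Info w
  info-gap [] _ _ _ = tt
  info-gap w@(C _ ∷ _) va cov h = top-absent va cov refl (above-top 4 w refl h)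
  info-gap w@(D _ ∷ _) va cov h = inj₂ (0 , refl , run-[] (top-absent va cov refl (above-top 4 w refl h)))
  info-gap w@(P _ ∷ _) va cov h = 0 , inj₁ refl , run-[] (top-absent va cov refl (above-top 4 w refl h))
  info-gap w@(Q _ ∷ _) va cov h = 0 , refl , run-[] (top-absent va cov refl (above-top 4 w refl h))

  not-chain : ∀ {x w} → ¬ Chain (3 + x) (D x ∷ w) → x ≤ 1
  not-chain {x} ¬h = ≮⇒≥ (¬h ∘ here)

  info-C : ∀ {c t} w → Valid c w → Covers w t → t ∈ π → Info (C t ∷ w) → Fits (C t) w → Info w
  info-C [] _ _ _ _ _ = tt
  info-C {t = t} w@(C _ ∷ _) va cov _ n (fitC h _) = top-absent va cov refl h
  info-C {t = t} w@(Q _ ∷ _) va cov _ n (fitC h _) = 0 , refl , run-[] (top-absent va cov refl h)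
  info-C {t = t} w@(D x ∷ _) va cov t∈ n (fitC h ¬ch) with 3 + x ≟ t
  ... | yes refl = inj₁ (not-chain ¬ch)
  ... | no ≢ = inj₂ (0 , refl , run-[] (top-absent va cov refl (≤∧≢⇒< h ≢)))
  info-C {t = t} w@(P a ∷ _) va cov t∈ n (fitC h ¬ch) with 6 + a ≟ t
  ... | yes refl = 1 , inj₂ (¬ch ∘ skip) , run-∷ t∈ (run-[] n)
  ... | no ≢ = 0 , inj₁ refl , run-[] (top-absent va cov refl (≤∧≢⇒< h ≢))

  info-P : ∀ {c a} w → Valid c w → Covers w a → a ∈ π → 3 + a ∈ π → Info (P a ∷ w) → Fits (P a) w → Info w
  info-P [] _ _ _ _ _ _ = tt
  info-P w@(C _ ∷ _) va cov _ _ _ (fitP h) = top-absent va cov refl h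
  info-P w@(Q _ ∷ _) va cov _ _ _ (fitP h) = 0 , refl , run-[] (top-absent va cov refl h)
  info-P {a = a} w@(D x ∷ _) va cov a∈ a∈′ info (fitP h) with 3 + x ≟ a
  ... | no ≢ = inj₂ (0 , refl , run-[] (top-absent va cov refl (≤∧≢⇒< h ≢)))
  -- An even run above makes the `D` the bottom of an odd progression. The alternative stems from a
  -- `C` at the top of the run, and then `fitC` leaves only the part 1 for a `D` in contact.
  ... | yes refl with info
  ...   | L , inj₁ e , r = inj₂ (2 + L , e , run-∷ a∈ (run-∷ a∈′ r))
  ...   | L , inj₂ ¬ch , r = inj₁ (not-chain ¬ch)
  info-P {a = a} w@(P b ∷ _) va cov a∈ a∈′ (L , i , r) (fitP h) with 6 + b ≟ a
  ... | no ≢ = 0 , inj₁ refl , run-[] (top-absent va cov refl (≤∧≢⇒< h ≢))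
  ... | yes refl = 2 + L , even-or i , run-∷ a∈ (run-∷ a∈′ r)
    where
    even-or : ∀ {w} → parity L ≡ 0ℙ ⊎ ¬ Chain (6 + b) (P b ∷ w) → parity L ≡ 0ℙ ⊎ ¬ Chain b w
    even-or (inj₁ e) = inj₁ e
    even-or (inj₂ ¬ch) = inj₂ (¬ch ∘ skip)

  info-Q : ∀ {c a} w → Valid c w → Covers w a → a ∈ π → 3 + a ∈ π → Info (Q a ∷ w) → Fits (Q a) w → Info w
  info-Q w va cov _ _ _ (fitQ h) = info-gap w va cov h
  info-Q w va cov a∈ a∈′ (L , e , r) fitQQ = 2 + L , e , run-∷ a∈ (run-∷ a∈′ r)

  LowerRun : ℕ → ℕ → Set
  LowerRun a k = (∀ i → i ≤ k → R (a + 3 * i)) × (∀ b → b + 3 ≡ a → ¬ R b)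

  extend : ∀ {a k} → R (3 + (a + 3 * k)) → LowerRun a k → LowerRun a (suc k)
  extend {a} {k} r (f , n) = g , n
    where
    g : ∀ i → i ≤ suc k → R (a + 3 * i)
    g i h with m≤n⇒m<n∨m≡n h
    ... | inj₁ (s≤s h′) = f i h′
    ... | inj₂ refl = subst R (sym (3*suc a k)) r

  start : ∀ {a} → R a → (∀ {b} → a ≡ 3 + b → ¬ R b) → LowerRun a 0
  start {a} r n = (λ { zero _ → subst R (sym (+-identityʳ a)) r }) , λ b e → n (trans (sym e) (+-comm b 3))

  covers-weaken : ∀ {w β γ} → γ ≤ β → Covers w β → Covers w γ
  covers-weaken {w} {β} {γ} le (sub , cov) = sub , λ z∈ → weaken (cov z∈)
    where
    weaken : ∀ {z} → z ∈ flat w ⊎ β ≤ z → z ∈ flat w ⊎ γ ≤ z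
    weaken (inj₁ z∈w) = inj₁ z∈w
    weaken (inj₂ h) = inj₂ (≤-trans le h)

  covers-tail : ∀ u {w β} → bottom u ≤ β → Covers (u ∷ w) β → Covers w (bottom u)
  covers-tail u {w} {β} le (sub , cov) = sub ∘ ∈-++⁺ʳ (parts u) , λ z∈ → split (cov z∈)
    where
    bottom≤ : ∀ u {z} → z ∈ parts u → bottom u ≤ z
    bottom≤ (C _) (here refl) = ≤-refl
    bottom≤ (D _) (here refl) = ≤-refl
    bottom≤ (P _) (here refl) = m≤n+m _ 3
    bottom≤ (P _) (there (here refl)) = ≤-refl
    bottom≤ (Q _) (here refl) = m≤n+m _ 3
    bottom≤ (Q _) (there (here refl)) = ≤-refl
    split : ∀ {z} → z ∈ flat (u ∷ w) ⊎ β ≤ z → z ∈ flat w ⊎ bottom u ≤ z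
    split (inj₂ h) = inj₂ (≤-trans le h)
    split (inj₁ z∈) with ∈-++⁻ (parts u) z∈
    ... | inj₁ z∈u = inj₂ (bottom≤ u z∈u)
    ... | inj₂ z∈w = inj₁ z∈w

  zero-run : ∀ {t} → R t → (∀ {b} → t ≡ 3 + b → ¬ R b) →
    ∃ λ a → ∃ λ k → parity k ≡ 0ℙ × t ≡ a + 3 * k × LowerRun a k
  zero-run {t} r n = t , 0 , refl , sym (+-identityʳ t) , start r n

  gap-run : ∀ {c x l t} w → Valid c w → flat w ≡ x ∷ l → 4 + x ≤ t → Covers w t → R t →
    ∃ λ a → ∃ λ k → parity k ≡ 0ℙ × t ≡ a + 3 * k × LowerRun a k
  gap-run w va eq h cov r = zero-run r λ { {b} refl rb →
    absent va cov
      (λ y∈ → ≤-trans (s≤s (linked-max (subst (Linked SchurGap) eq (valid-linked va)) (subst (_ ∈_) eq y∈)))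
                      (≤-pred3 h))
      (s≤s (m≤n+m b 2)) (proj₁ (fromR rb)) }

  -- Below a `C` the progression consists of whole `P`s, hence of an even number of parts: a `D` in
  -- contact can only be 1, which `R` omits.
  lower-run : ∀ {c t} w → Valid c w → Above 3 w t → ¬ Chain t w → Covers w t → R t →
    ∃ λ a → ∃ λ k → parity k ≡ 0ℙ × t ≡ a + 3 * k × LowerRun a k
  lower-run [] va h ¬ch cov r = zero-run r λ { {b} refl rb →
    absent va cov (λ ()) (s≤s (m≤n+m b 2)) (proj₁ (fromR rb)) }
  lower-run w@(C _ ∷ _) va h ¬ch cov r = gap-run w va refl h cov r
  lower-run w@(Q _ ∷ _) va h ¬ch cov r = gap-run w va refl h cov r
  lower-run {t = t} w@(D x ∷ _) va h ¬ch cov r with 3 + x ≟ t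
  ... | no ≢ = gap-run w va refl (≤∧≢⇒< h ≢) cov r
  ... | yes refl = zero-run r λ { refl rx → <⇒≱ (proj₂ (fromR rx)) (not-chain ¬ch) }
  lower-run {t = t} w@(P b ∷ w′) va h ¬ch cov r with 6 + b ≟ t
  ... | no ≢ = gap-run w va refl (≤∧≢⇒< h ≢) cov r
  ... | yes refl with va
  ...   | add (fitP h′) (_ , 1<b , _) va′
    with lower-run w′ va′ h′ (¬ch ∘ skip) (covers-tail (P b) (m≤n+m b 6) cov)
                   (toR (within cov (there (here refl))) 1<b)
  ...     | a , k , e , refl , run =
    a , 2 + k , e , 6+ , extend (subst R (sym (cong (3 +_) (3*suc a k))) r)
      (extend (toR (within cov (here refl)) (s≤s (s≤s z≤n))) run)
    where
    6+ : 6 + (a + 3 * k) ≡ a + 3 * (2 + k)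
    6+ = sym (trans (3*suc a (suc k)) (cong (3 +_) (3*suc a k)))

  -- A progression descending from the top of a `Q` comprises whole `Q`s. Dropping two parts at a
  -- time follows `fitQQ` down; when `k` reaches 0, the lower member `a` lies below the alleged
  -- smallest element.
  Q-lower : ∀ {c a a₀ w} k → Valid c (Q a ∷ w) → Covers (Q a ∷ w) (4 + a) → parity k ≡ 0ℙ →
    3 + a ≡ a₀ + 3 * k → LowerRun a₀ k → ⊥
  Q-lower {a = a} {a₀} zero (add _ (_ , 1<a , _) _) (sub , _) _ eq (_ , n) =
    n a (trans (+-comm a 3) (trans eq (+-identityʳ a₀))) (toR (sub (there (here refl))) 1<a)
  Q-lower {a = a} {a₀} {w} (suc (suc k)) va cov e eq (f , n)
    with +-cancelˡ-≡ 3 _ _ (trans eq (trans (3*suc a₀ (suc k)) (cong (3 +_) (3*suc a₀ k))))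
  ... | a≡3+z = go a≡3+z va (covers-tail (Q a) (m≤n+m a 4) cov)
    where
    z = a₀ + 3 * k
    z∈ : z ∈ π
    z∈ = proj₁ (fromR (f k (m≤n+m k 2)))
    go : ∀ {b w} → b ≡ 3 + z → Valid _ (Q b ∷ w) → Covers w b → ⊥
    go b≡ (add (fitQ h) _ va′) cov′ =
      absent va′ cov′ (λ y∈ → ≤-pred3 (≤-trans (above-max 4 va′ h y∈) (≤-reflexive b≡)))
        (≤-trans (s≤s (m≤n+m z 2)) (≤-reflexive (sym b≡))) z∈
    go b≡ (add fitQQ _ va′) cov′ =
      Q-lower k va′ (covers-weaken (m≤n+m _ 2) cov′) e (+-cancelˡ-≡ 3 _ _ b≡)
        ((λ i h → f i (≤-trans h (m≤n+m k 2))) , n)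

  info-tail : ∀ {u w} → Valid c (u ∷ w) → Covers (u ∷ w) (suc (top u)) → Info (u ∷ w) → Info w
  info-tail {u = C t} {w} (add f _ va) cov info =
    info-C w va (covers-tail (C t) (n≤1+n t) cov) (within cov (here refl)) info f
  info-tail {u = D x} {w} (add (fitD h) _ va) cov info =
    info-gap w va (covers-tail (D x) (n≤1+n x) cov) h
  info-tail {u = P a} {w} (add f _ va) cov info =
    info-P w va (covers-tail (P a) (m≤n+m a 4) cov) (within cov (there (here refl))) (within cov (here refl)) info f
  info-tail {u = Q a} {w} (add f _ va) cov info =
    info-Q w va (covers-tail (Q a) (m≤n+m a 4) cov) (within cov (there (here refl))) (within cov (here refl)) info f

  bottom≤top : ∀ u → bottom u ≤ 1 + top u
  bottom≤top (C x) = n≤1+n x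
  bottom≤top (D x) = n≤1+n x
  bottom≤top (P a) = m≤n+m a 4
  bottom≤top (Q a) = m≤n+m a 4

  top<bottom : ∀ {u u′ w} → Fits u (u′ ∷ w) → suc (top u′) ≤ bottom u
  top<bottom {u′ = u′} f = go f
    where
    top≤base : ∀ u → top u ≤ base u
    top≤base (C x) = n≤1+n x
    top≤base (D x) = ≤-refl
    top≤base (P a) = ≤-refl
    top≤base (Q a) = n≤1+n (3 + a)
    via : ∀ {n} → 3 + base u′ ≤ n → suc (top u′) ≤ n
    via = ≤-trans (s≤s (≤-trans (top≤base u′) (m≤n+m _ 2)))
    go : ∀ {u w} → Fits u (u′ ∷ w) → suc (top u′) ≤ bottom u
    go (fitC h _) = via h
    go (fitD h) = via (<⇒≤ h)
    go (fitP h) = via h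
    go (fitQ h) = via (<⇒≤ h)
    go fitQQ = m≤n+m _ 2

  C-single : ∀ {t w} → Valid c (C t ∷ w) → Covers (C t ∷ w) (suc t) → Info (C t ∷ w) → ¬ InPair t
  C-single {t} {w} (add (fitC h ¬ch) (e , 1<t) va) cov n (t∈ , _ , ¬l , _)
    with lower-run w va h ¬ch (covers-tail (C t) (n≤1+n t) cov) (toR t∈ 1<t)
  ... | a , k , ek , eq , f , n′ = ¬l (e , a , suc k ,
    ((λ { i (s≤s i≤k) → f i i≤k }) , n′ ,
      λ r → n (subst (_∈ π) (trans (3*suc a k) (cong (3 +_) (sym eq))) (proj₁ (fromR r)))) ,
    parity⇒odd (suc k) (parity-suc k ek) , eq)

  D-single : ∀ {x w} → Valid c (D x ∷ w) → Covers (D x ∷ w) (suc x) → Info (D x ∷ w) → 1 < x → ¬ InPair x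
  D-single _ _ (inj₁ x≤1) 1<x _ = <⇒≱ 1<x x≤1
  D-single {x} {w} (add (fitD h) (e , _) va) cov (inj₂ (L , eL , r)) 1<x (x∈ , _ , _ , ¬s)
    with run-∷ x∈ r
  ... | f , n = ¬s (e , x , suc L ,
    ((λ i i< → toR (f i i<) (≤-trans 1<x (m≤m+n x _))) ,
     (λ b b≡ rb → absent va (covers-tail (D x) (n≤1+n x) cov)
        (λ y∈ → ≤-pred3 (≤-trans (above-max 4 va h y∈) (≤-reflexive (trans (sym b≡) (+-comm b 3)))))
        (≤-trans (s≤s (m≤n+m b 2)) (≤-reflexive (trans (+-comm 3 b) b≡)))
        (proj₁ (fromR rb))) ,
     n ∘ proj₁ ∘ fromR) ,
    parity⇒odd (suc L) (parity-suc L eL) , refl)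

  P-paired : ∀ {a} → parity a ≡ c → 1 < a → a ∈ π → 3 + a ∈ π → InPair a × InPair (3 + a)
  P-paired {a} e 1<a a∈ a∈′ =
    (a∈ , inj₁ (subst (_∈ π) (+-comm 3 a) a∈′) ,
      (λ { (_ , b , suc k , (_ , _ , n) , _ , refl) →
         n (subst R (sym (3*suc b k)) (toR a∈′ (s≤s (s≤s z≤n))))
         ; (_ , b , zero , _ , () , _) }) ,
      (λ { (e′ , _) → parity-clash a e e′ })) ,
    (a∈′ , inj₂ (a , a∈ , +-comm a 3) ,
      (λ { (e′ , _) → parity-clash (3 + a) e′ (parity-suc a e) }) ,
      (λ { (_ , _ , _ , (_ , n , _) , _ , refl) → n a (+-comm a 3) (toR a∈ 1<a) }))

  Q-paired : ∀ {a w} → Valid c (Q a ∷ w) → Covers (Q a ∷ w) (4 + a) → Info (Q a ∷ w) →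
    InPair a × InPair (3 + a)
  Q-paired {a} va@(add _ (e , 1<a , _) _) cov@(sub , _) (L , eL , r) =
    (a∈ , inj₁ (subst (_∈ π) (+-comm 3 a) a∈′) ,
      (λ { (e′ , _) → parity-clash a e′ e }) ,
      (λ { (_ , _ , L′ , m , o , refl) → parity-clash L′
             (trans (cong parity (sym (run-length 1<a (run-∷ a∈ (run-∷ a∈′ r)) m))) eL)
             (odd⇒parity L′ o) })) ,
    (a∈′ , inj₂ (a , a∈ , +-comm a 3) ,
      (λ { (_ , b , suc k , (f , n , _) , o , eq) →
             Q-lower k va cov (parity-pred k (odd⇒parity (suc k) o)) eq ((λ i i≤k → f i (s≤s i≤k)) , n)
         ; (_ , _ , zero , _ , () , _) }) ,
      (λ { (e′ , _) → parity-clash (3 + a) (parity-suc⁻¹ a e) e′ }))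
    where
    a∈ : a ∈ π
    a∈ = sub (there (here refl))
    a∈′ : 3 + a ∈ π
    a∈′ = sub (here refl)

  paired-sound : ∀ {u w x} → Valid c (u ∷ w) → Covers (u ∷ w) (suc (top u)) → Info (u ∷ w) →
    Paired (u ∷ w) x → InPair x
  paired-sound (add _ (e , 1<a , _) _) cov _ upperP =
    proj₂ (P-paired e 1<a (within cov (there (here refl))) (within cov (here refl)))
  paired-sound (add _ (e , 1<a , _) _) cov _ lowerP =
    proj₁ (P-paired e 1<a (within cov (there (here refl))) (within cov (here refl)))
  paired-sound va cov info upperQ = proj₂ (Q-paired va cov info)
  paired-sound va cov info lowerQ = proj₁ (Q-paired va cov info)
  paired-sound {u} {_ ∷ _} va@(add f _ va′) cov info (later p) =
    paired-sound va′ (covers-weaken (top<bottom f) (covers-tail u (bottom≤top u) cov)) (info-tail va cov info) p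

  paired-complete : ∀ {u w x} → Valid c (u ∷ w) → Covers (u ∷ w) (suc (top u)) → Info (u ∷ w) →
    x ∈ flat (u ∷ w) → 1 < x → InPair x → Paired (u ∷ w) x
  paired-complete {u} va cov info x∈ 1<x ip with ∈-++⁻ (parts u) x∈
  paired-complete {C _} va cov info x∈ 1<x ip | inj₁ (here refl) = ⊥-elim (C-single va cov info ip)
  paired-complete {D _} va cov info x∈ 1<x ip | inj₁ (here refl) = ⊥-elim (D-single va cov info 1<x ip)
  paired-complete {P _} va cov info x∈ 1<x ip | inj₁ (here refl) = upperP
  paired-complete {P _} va cov info x∈ 1<x ip | inj₁ (there (here refl)) = lowerP
  paired-complete {Q _} va cov info x∈ 1<x ip | inj₁ (here refl) = upperQ
  paired-complete {Q _} va cov info x∈ 1<x ip | inj₁ (there (here refl)) = lowerQ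
  paired-complete {u} {_ ∷ _} va@(add f _ va′) cov info x∈ 1<x ip | inj₂ x∈w =
    later (paired-complete va′ (covers-weaken (top<bottom f) (covers-tail u (bottom≤top u) cov))
             (info-tail va cov info) x∈w 1<x ip)

paired⇔ : ∀ {c w R} → Valid c w →
  (toR : ∀ {z} → z ∈ flat w → 1 < z → R z) (fromR : ∀ {z} → R z → z ∈ flat w × 1 < z) →
  ∀ {x} → x ∈ flat w → 1 < x →
  (Paired w x → Pairing.InPair c (flat w) R toR fromR x) ×
  (Pairing.InPair c (flat w) R toR fromR x → Paired w x)
paired⇔ {c} {u ∷ w} {R} va toR fromR x∈ 1<x =
  paired-sound va cov info , paired-complete va cov info x∈ 1<x
  where
  open Pairing c (flat (u ∷ w)) R toR fromR
  cov : ∀ {β} → Covers (u ∷ w) β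
  cov = (λ z∈ → z∈) , inj₁
  -- Nothing lies above the whole word, so `β` is free and is taken as `4 + base u`.
  info : Info (u ∷ w)
  info = info-gap (u ∷ w) va cov ≤-refl

-- Counting parts

count-cong : ∀ {F G : ℕ → Set} {π k} → (∀ x → x ∈ π → F x ⇔ G x) → CountIs F π k → CountIs G π k
count-cong eqv (S , sub , mem , len) =
  S , sub , (λ x x∈ → mk⇔ (⇒ (eqv x x∈) ∘ ⇒ (mem x x∈)) (⇐ (mem x x∈) ∘ ⇐ (eqv x x∈))) , len

count-yes : ∀ {F : ℕ → Set} {π k x} → F x → CountIs F π k → CountIs F (x ∷ π) (suc k)
count-yes {x = x} q (S , sub , mem , len) = x ∷ S , refl ∷ sub , mem′ , cong suc len
  where
  mem′ : ∀ y → y ∈ x ∷ _ → (y ∈ x ∷ S ⇔ _)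
  mem′ y (here refl) = mk⇔ (λ _ → q) (λ _ → here refl)
  mem′ y (there y∈) = mk⇔ (λ { (here refl) → q ; (there y∈S) → ⇒ (mem y y∈) y∈S }) (there ∘ ⇐ (mem y y∈))

count-no : ∀ {F : ℕ → Set} {π k x} → ¬ F x → CountIs F π k → CountIs F (x ∷ π) k
count-no {x = x} ¬q (S , sub , mem , len) = S , x ∷ʳ sub , mem′ , len
  where
  mem′ : ∀ y → y ∈ x ∷ _ → (y ∈ S ⇔ _)
  mem′ y (here refl) = mk⇔ (λ y∈S → ⇒ (mem y (lookup sub y∈S)) y∈S) (⊥-elim ∘ ¬q)
  mem′ y (there y∈) = mem y y∈

sublist-unique : ∀ {S S′ π : List ℕ} → AllPairs _≢_ π → S ⊆ π → S′ ⊆ π →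
  (∀ {x} → x ∈ π → x ∈ S ⇔ x ∈ S′) → S ≡ S′
sublist-unique _ [] [] _ = refl
sublist-unique (_ ∷ u) (_ ∷ʳ s) (_ ∷ʳ s′) eqv = sublist-unique u s s′ (eqv ∘ there)
sublist-unique (∉ ∷ _) (_ ∷ʳ s) (refl ∷ s′) eqv =
  ⊥-elim (All.lookup ∉ (lookup s (⇐ (eqv (here refl)) (here refl))) refl)
sublist-unique (∉ ∷ _) (refl ∷ s) (_ ∷ʳ s′) eqv =
  ⊥-elim (All.lookup ∉ (lookup s′ (⇒ (eqv (here refl)) (here refl))) refl)
sublist-unique (∉ ∷ u) (refl ∷ s) (refl ∷ s′) eqv =
  cong (_ ∷_) (sublist-unique u s s′ λ x∈ →
    mk⇔ (strip x∈ ∘ ⇒ (eqv (there x∈)) ∘ there) (strip x∈ ∘ ⇐ (eqv (there x∈)) ∘ there))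
  where
  strip : ∀ {x T} → x ∈ _ → x ∈ _ ∷ T → x ∈ T
  strip x∈ (here refl) = ⊥-elim (All.lookup ∉ x∈ refl)
  strip _ (there x∈T) = x∈T

distinct : ∀ {π} → IsSchur π → AllPairs _≢_ π
distinct (_ , lk) = AllPairs.map (λ y<x x≡y → <-irrefl (sym x≡y) y<x)
  (Linked⇒AllPairs (λ y<x z<y → <-trans z<y y<x)
    (Linked.map (λ g → ≤-trans (m≤n+m _ 2) (gap-size g)) lk))

-- As the parts are distinct, a sublist is determined by its members; hence any given count may be
-- replaced by the one read off from the word.
count-unique : ∀ {F : ℕ → Set} {π k k′} → IsSchur π → CountIs F π k → CountIs F π k′ → k ≡ k′
count-unique s (S , sub , mem , refl) (S′ , sub′ , mem′ , refl) =
  cong length (sublist-unique (distinct s) sub sub′ λ x∈ →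
    mk⇔ (⇐ (mem′ _ x∈) ∘ ⇒ (mem _ x∈)) (⇐ (mem _ x∈) ∘ ⇒ (mem′ _ x∈)))

count-#c : ∀ {c w} → Valid c w → CountIs (λ x → parity x ≡ c) (flat w) (#c w)
count-#c [] = [] , [] , (λ _ ()) , refl
count-#c (add {C _} _ (e , _) va) = count-yes e (count-#c va)
count-#c (add {D x} _ (e , _) va) = count-no (λ p → parity-clash x p e) (count-#c va)
count-#c (add {P a} _ (e , _) va) =
  count-no (λ p → parity-clash (3 + a) p (parity-suc a e)) (count-yes e (count-#c va))
count-#c (add {Q a} _ (e , _) va) =
  count-yes (parity-suc⁻¹ a e) (count-no (λ p → parity-clash a p e) (count-#c va))

count-#d : ∀ {c w} → Valid c w → CountIs (λ x → parity x ≡ c ⁻¹) (flat w) (#d w)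
count-#d [] = [] , [] , (λ _ ()) , refl
count-#d (add {C x} _ (e , _) va) = count-no (parity-clash x e) (count-#d va)
count-#d (add {D x} _ (e , _) va) = count-yes e (count-#d va)
count-#d (add {P a} _ (e , _) va) =
  count-yes (parity-suc a e) (count-no (parity-clash a e) (count-#d va))
count-#d (add {Q a} _ (e , _) va) =
  count-no (parity-clash (3 + a) (parity-suc⁻¹ a e)) (count-yes e (count-#d va))

odd⇔ : ∀ x → parity x ≡ 1ℙ ⇔ IsOdd x
odd⇔ x = mk⇔ (parity⇒odd x) (odd⇒parity x)

even⇔ : ∀ x → parity x ≡ 0ℙ ⇔ IsEven x
even⇔ x = mk⇔ (parity⇒even x) (even⇒parity x)

keepIf-⊆ : ∀ {A : Set} (d : Dec A) xs → keepIf d xs ⊆ xs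
keepIf-⊆ (yes _) xs = ⊆-refl
keepIf-⊆ (no _) [] = []
keepIf-⊆ (no a) (x ∷ xs) = x ∷ʳ keepIf-⊆ (no a) xs

paired-⊆ : ∀ r w → paired r w ⊆ flat w
paired-⊆ r [] = []
paired-⊆ r (C x ∷ w) = x ∷ʳ paired-⊆ r w
paired-⊆ r (D x ∷ w) = x ∷ʳ paired-⊆ r w
paired-⊆ r (P a ∷ w) = ++⁺ (keepIf-⊆ (a % 3 ≟ r) _) (paired-⊆ r w)
paired-⊆ r (Q a ∷ w) = ++⁺ (keepIf-⊆ (a % 3 ≟ r) _) (paired-⊆ r w)

∈-pairedParts⁻ : ∀ r a {x} → x ∈ pairedParts r a → (x ≡ 3 + a ⊎ x ≡ a) × x % 3 ≡ r
∈-pairedParts⁻ r a x∈ with a % 3 ≟ r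
∈-pairedParts⁻ r a (here refl) | yes e = inj₁ refl , e
∈-pairedParts⁻ r a (there (here refl)) | yes e = inj₂ refl , e

∈-pairedParts⁺ : ∀ r a {x} → x ≡ 3 + a ⊎ x ≡ a → x % 3 ≡ r → x ∈ pairedParts r a
∈-pairedParts⁺ r a x≡ e with a % 3 ≟ r | x≡
... | yes _ | inj₁ refl = here refl
... | yes _ | inj₂ refl = there (here refl)
... | no ≢ | inj₁ refl = ⊥-elim (≢ e)
... | no ≢ | inj₂ refl = ⊥-elim (≢ e)

∈-paired⁻ : ∀ r w {x} → x ∈ paired r w → Paired w x × x % 3 ≡ r
∈-paired⁻ r (C _ ∷ w) x∈ = map₁ later (∈-paired⁻ r w x∈)
∈-paired⁻ r (D _ ∷ w) x∈ = map₁ later (∈-paired⁻ r w x∈)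
∈-paired⁻ r (P a ∷ w) x∈ with ∈-++⁻ (pairedParts r a) x∈
... | inj₂ x∈w = map₁ later (∈-paired⁻ r w x∈w)
... | inj₁ x∈a with ∈-pairedParts⁻ r a x∈a
...   | inj₁ refl , e = upperP , e
...   | inj₂ refl , e = lowerP , e
∈-paired⁻ r (Q a ∷ w) x∈ with ∈-++⁻ (pairedParts r a) x∈
... | inj₂ x∈w = map₁ later (∈-paired⁻ r w x∈w)
... | inj₁ x∈a with ∈-pairedParts⁻ r a x∈a
...   | inj₁ refl , e = upperQ , e
...   | inj₂ refl , e = lowerQ , e

∈-paired⁺ : ∀ r {w x} → Paired w x → x % 3 ≡ r → x ∈ paired r w
∈-paired⁺ r (upperP {a}) e = ∈-++⁺ˡ (∈-pairedParts⁺ r a (inj₁ refl) e)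
∈-paired⁺ r (lowerP {a}) e = ∈-++⁺ˡ (∈-pairedParts⁺ r a (inj₂ refl) e)
∈-paired⁺ r (upperQ {a}) e = ∈-++⁺ˡ (∈-pairedParts⁺ r a (inj₁ refl) e)
∈-paired⁺ r (lowerQ {a}) e = ∈-++⁺ˡ (∈-pairedParts⁺ r a (inj₂ refl) e)
∈-paired⁺ r (later {C _} p) e = ∈-paired⁺ r p e
∈-paired⁺ r (later {D _} p) e = ∈-paired⁺ r p e
∈-paired⁺ r (later {P a} p) e = ∈-++⁺ʳ (pairedParts r a) (∈-paired⁺ r p e)
∈-paired⁺ r (later {Q a} p) e = ∈-++⁺ʳ (pairedParts r a) (∈-paired⁺ r p e)

paired->1 : ∀ {c w x} → Valid c w → Paired w x → 1 < x
paired->1 _ upperP = s≤s (s≤s z≤n)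
paired->1 _ upperQ = s≤s (s≤s z≤n)
paired->1 (add _ (_ , 1<a , _) _) lowerP = 1<a
paired->1 (add _ (_ , 1<a , _) _) lowerQ = 1<a
paired->1 (add _ _ va) (later p) = paired->1 va p

count-paired : ∀ {F : ℕ → Set} w r → (∀ {x} → x ∈ flat w → Paired w x ⇔ F x) →
  CountIs (λ x → F x × x % 3 ≡ r) (flat w) (length (paired r w))
count-paired w r eqv = paired r w , paired-⊆ r w ,
  (λ x x∈ → mk⇔ (map₁ (⇒ (eqv x∈)) ∘ ∈-paired⁻ r w)
                 (λ { (f , e) → ∈-paired⁺ r (⇐ (eqv x∈) f) e })) , refl

paired⇔lower : ∀ {v x} → Valid 0ℙ v → x ∈ flat v → Paired v x ⇔ LowerPair (flat v) x
paired⇔lower {v} {x} va x∈ = mk⇔ to from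
  where
  equiv : 1 < x → _
  equiv = paired⇔ {R = PartGt1 (flat v)} va _,_ id x∈
  to : Paired v x → LowerPair (flat v) x
  to p with proj₁ (equiv (paired->1 va p)) p
  ... | x∈ , n , ¬l , ¬s = x∈ , paired->1 va p , n ,
    (λ { (e , l) → ¬l (even⇒parity x e , l) }) , (λ { (e , s) → ¬s (odd⇒parity x e , s) })
  from : LowerPair (flat v) x → Paired v x
  from (x∈ , 1<x , n , ¬l , ¬s) = proj₂ (equiv 1<x) (x∈ , n ,
    (λ { (e , l) → ¬l (parity⇒even x e , l) }) , (λ { (e , s) → ¬s (parity⇒odd x e , s) }))

restricted->1 : ∀ {π x} → Restricted π → x ∈ π → 1 < x
restricted->1 {x = x} rs x∈ with parity x in e | All.lookup rs x∈
... | 0ℙ | _ , ev = ≤-trans (s≤s (s≤s z≤n)) (ev (parity⇒even x e))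
... | 1ℙ | od , _ = ≤-trans (s≤s (s≤s z≤n)) (od (parity⇒odd x e))

paired⇔upper : ∀ {w x} → Valid 1ℙ w → Restricted (flat w) → x ∈ flat w → Paired w x ⇔ UpperPair (flat w) x
paired⇔upper {w} {x} va rs x∈ = mk⇔ to from
  where
  equiv : _
  equiv = paired⇔ {R = _∈ flat w} va (λ z∈ _ → z∈) (λ z∈ → z∈ , restricted->1 rs z∈) x∈ (restricted->1 rs x∈)
  to : Paired w x → UpperPair (flat w) x
  to p with proj₁ equiv p
  ... | x∈ , n , ¬l , ¬s = x∈ , n ,
    (λ { (e , l) → ¬l (odd⇒parity x e , l) }) , (λ { (e , s) → ¬s (even⇒parity x e , s) })
  from : UpperPair (flat w) x → Paired w x
  from (x∈ , n , ¬l , ¬s) = proj₂ equiv (x∈ , n ,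
    (λ { (e , l) → ¬l (parity⇒odd x e , l) }) , (λ { (e , s) → ¬s (parity⇒even x e , s) }))

-- From the correspondence to the bijections

record Corresponds (π π′ : List ℕ) : Set where
  field
    {source target} : Word
    source-flat : flat source ≡ π
    target-flat : flat target ≡ π′
    source-valid : Valid 1ℙ source
    target-valid : Valid 0ℙ target
    lowers : Lower source target
    restricted : Restricted π

correspond-from : ∀ {π} → IsSchur π → Restricted π → ∃ (Corresponds π)
correspond-from {π} (_ , lk) rs
  with parse (All.tabulate λ x∈ → let h = restricted->1 rs x∈ in <-trans (s≤s z≤n) h , λ _ → h) lk
... | w , wv , refl with lower-total wv rs
...   | v , l , vv = flat v , record
  { source-flat = refl ; target-flat = refl ; source-valid = wv ; target-valid = vv
  ; lowers = l ; restricted = rs }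

correspond-to : ∀ {π′} → IsSchur π′ → ∃ λ π → Corresponds π π′
correspond-to (pos , lk) with parse (All.map (λ 0<x → 0<x , even>1 0<x) pos) lk
... | v , vv , refl with lower-onto _ refl vv
...   | w , l , wv = flat w , record
  { source-flat = refl ; target-flat = refl ; source-valid = wv ; target-valid = vv
  ; lowers = l ; restricted = lower-restricted l vv }

correspond-functional : ∀ {π π₁ π₂} → Corresponds π π₁ → Corresponds π π₂ → π₁ ≡ π₂
correspond-functional
  record { source-flat = refl ; target-flat = refl ; source-valid = wv ; lowers = l }
  record { source-flat = eq ; target-flat = refl ; source-valid = wv′ ; lowers = l′ }
  with flat-injective wv′ wv eq
... | refl = cong flat (lower-functional l l′)

correspond-injective : ∀ {π₁ π₂ π} → Corresponds π₁ π → Corresponds π₂ π → π₁ ≡ π₂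
correspond-injective
  record { source-flat = refl ; target-flat = refl ; source-valid = wv ; target-valid = vv ; lowers = l }
  record { source-flat = refl ; target-flat = eq ; source-valid = wv′ ; target-valid = vv′ ; lowers = l′ }
  with flat-injective vv′ vv eq
... | refl = cong flat (lower-injective wv wv′ l l′)

-- The correspondence depends on the two lists alone and not on the parameters, so the same map
-- yields both families of bijections once membership is shown to transfer.
bijection : (A B : List ℕ → Set) →
  (∀ {π} → A π → IsSchur π × Restricted π) → (∀ {π} → B π → IsSchur π) →
  (∀ {π π′} → Corresponds π π′ → A π ⇔ B π′) →
  Bijection (PartSetoid A) (PartSetoid B)
bijection A B schurA schurB A⇔B = record
  { to = λ { (_ , a) → _ , ⇒ (A⇔B (proj₂ (image a))) a }
  -- The image is computed from a membership proof, so even equal lists call for functionality.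
  ; cong = λ { {_ , a} {_ , b} refl → correspond-functional (proj₂ (image a)) (proj₂ (image b)) }
  ; bijective =
      (λ { {_ , a} {_ , b} eq → correspond-injective (proj₂ (image a))
             (subst (Corresponds _) (sym eq) (proj₂ (image b))) }) ,
      λ { (_ , b) → (_ , ⇐ (A⇔B (proj₂ (correspond-to (schurB b)))) b) ,
          λ { {_ , a} refl → correspond-functional (proj₂ (image a)) (proj₂ (correspond-to (schurB b))) } }
  }
  where
  image : ∀ {π} → A π → ∃ (Corresponds π)
  image a = correspond-from (proj₁ (schurA a)) (proj₂ (schurA a))

count-transfer : ∀ {F G : ℕ → Set} {π π′ k l} → IsSchur π → CountIs F π k → CountIs G π′ l → k ≡ l →
  ∀ {j} → CountIs F π j → CountIs G π′ j
count-transfer s f g refl f′ = subst (CountIs _ _) (count-unique s f f′) g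

open import Data.Integer as ℤ using (+_; _-_)

-- Over the integers a negative target size needs no separate case: both equations then fail for
-- every natural `a`.
difference⇔ : ∀ {n a b} → n ≡ a + b ⇔ + a ≡ + n - + b
difference⇔ {n} {a} {b} = mk⇔
  (λ { refl → sym (//-rightDividesʳ (+ b) (+ a)) })
  (λ eq → ℤ.+-injective (sym (trans (cong (ℤ._+ + b) eq) (//-rightDividesˡ (+ b) (+ n)))))

length-flat : ∀ w → length (flat w) ≡ #c w + #d w
length-flat [] = refl
length-flat (C _ ∷ w) = cong suc (length-flat w)
length-flat (D _ ∷ w) = trans (cong suc (length-flat w)) (sym (+-suc (#c w) (#d w)))
length-flat (P _ ∷ w) = cong suc (trans (cong suc (length-flat w)) (sym (+-suc (#c w) (#d w))))
length-flat (Q _ ∷ w) = cong suc (trans (cong suc (length-flat w)) (sym (+-suc (#c w) (#d w))))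

refined : ∀ ω ε p₁ p₂ n {π π′} → Corresponds π π′ →
  𝒟*-pred ω ε p₁ p₂ n π ⇔ 𝒟-pred ω ε p₁ p₂ (+ n - + (2 * (ω + 2 * ε))) π′
refined ω ε p₁ p₂ n record { source = w ; target = v ; source-flat = refl ; target-flat = refl
  ; source-valid = wv ; target-valid = vv ; lowers = l ; restricted = rs } = mk⇔
  (λ { (_ , _ , s , o , e , c₁ , c₂) →
       vs , ⇒ difference⇔ (trans (sym s) (size (ωd o) (εd e))) ,
       count-transfer ws wo vo (lower-#c l) o , count-transfer ws we ve (lower-#d l) e ,
       count-transfer ws (wp 1) (vp 1) (lower-paired 1 l) c₁ ,
       count-transfer ws (wp 2) (vp 2) (lower-paired 2 l) c₂ })
  (λ { (_ , s , o , e , c₁ , c₂) →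
       ws , rs , trans (size (count-unique vs o vo) (count-unique vs e ve)) (sym (⇐ difference⇔ s)) ,
       count-transfer vs vo wo (sym (lower-#c l)) o , count-transfer vs ve we (sym (lower-#d l)) e ,
       count-transfer vs (vp 1) (wp 1) (sym (lower-paired 1 l)) c₁ ,
       count-transfer vs (vp 2) (wp 2) (sym (lower-paired 2 l)) c₂ })
  where
  ws : IsSchur (flat w)
  ws = valid-schur wv
  vs : IsSchur (flat v)
  vs = valid-schur vv
  wo : CountIs IsOdd (flat w) (#c w)
  wo = count-cong (λ x _ → odd⇔ x) (count-#c wv)
  we : CountIs IsEven (flat w) (#d w)
  we = count-cong (λ x _ → even⇔ x) (count-#d wv)
  vo : CountIs IsOdd (flat v) (#d v)
  vo = count-cong (λ x _ → odd⇔ x) (count-#d vv)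
  ve : CountIs IsEven (flat v) (#c v)
  ve = count-cong (λ x _ → even⇔ x) (count-#c vv)
  wp : ∀ r → CountIs (λ x → UpperPair (flat w) x × x % 3 ≡ r) (flat w) (length (paired r w))
  wp r = count-paired w r (paired⇔upper wv rs)
  vp : ∀ r → CountIs (λ x → LowerPair (flat v) x × x % 3 ≡ r) (flat v) (length (paired r v))
  vp r = count-paired v r (paired⇔lower vv)
  ωd : CountIs IsOdd (flat w) ω → ω ≡ #d v
  ωd o = trans (count-unique ws o wo) (lower-#c l)
  εd : CountIs IsEven (flat w) ε → ε ≡ #c v
  εd e = trans (count-unique ws e we) (lower-#d l)
  size : ω ≡ #d v → ε ≡ #c v → sum (flat w) ≡ sum (flat v) + 2 * (ω + 2 * ε)
  size refl refl = lower-sum l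

-- `m` counts odd parts once and even parts twice, so `2 * m` is the very loss computed in
-- `lower-sum`.
weighted : ∀ m n {π π′} → Corresponds π π′ → 𝒟m*-pred m n π ⇔ 𝒟m-pred m (+ n - + (2 * m)) π′
weighted m n record { source = w ; target = v ; source-flat = refl ; target-flat = refl
  ; source-valid = wv ; target-valid = vv ; lowers = l ; restricted = rs } = mk⇔
  (λ { (_ , _ , s , e , ce , em) → let m≡ = trans (sym em) (source-m ce) in
       vs , ⇒ difference⇔ (trans (sym s) (size m≡)) , #c v , ve , trans target-m (sym m≡) })
  (λ { (_ , s , e , ce , em) →
       let m≡ = trans (sym em) (trans (cong (λ k → length (flat v) + k) (count-unique vs ce ve)) target-m) in
       ws , rs , trans (size m≡) (sym (⇐ difference⇔ s)) , #d w , we , trans (source-m we) (sym m≡) })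
  where
  ws : IsSchur (flat w)
  ws = valid-schur wv
  vs : IsSchur (flat v)
  vs = valid-schur vv
  we : CountIs IsEven (flat w) (#d w)
  we = count-cong (λ x _ → even⇔ x) (count-#d wv)
  ve : CountIs IsEven (flat v) (#c v)
  ve = count-cong (λ x _ → even⇔ x) (count-#c vv)
  twice : ∀ d c → d + c + c ≡ d + 2 * c
  twice = solve-∀
  target-m : length (flat v) + #c v ≡ #d v + 2 * #c v
  target-m = trans (cong (_+ #c v) (trans (length-flat v) (+-comm (#c v) (#d v)))) (twice (#d v) (#c v))
  source-m : ∀ {e} → CountIs IsEven (flat w) e → length (flat w) + e ≡ #d v + 2 * #c v
  source-m ce rewrite count-unique ws ce we | length-flat w | lower-#c l | lower-#d l = twice (#d v) (#c v)
  size : m ≡ #d v + 2 * #c v → sum (flat w) ≡ sum (flat v) + 2 * m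
  size refl = lower-sum l

theorem3 : ((ω ε p₁ p₂ n : ℕ) →
    Bijection (𝒟* ω ε p₁ p₂ n) (𝒟 ω ε p₁ p₂ (+ n - + (2 * (ω + 2 * ε)))))
    × ((m n : ℕ) → Bijection (𝒟m* m n) (𝒟m m (+ n - + (2 * m))))
theorem3 =
  (λ ω ε p₁ p₂ n → bijection _ _ (λ a → proj₁ a , proj₁ (proj₂ a)) proj₁ (refined ω ε p₁ p₂ n)) ,
  (λ m n → bijection _ _ (λ a → proj₁ a , proj₁ (proj₂ a)) proj₁ (weighted m n))
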